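{- For all integers $k,r\geq 2$ there is a constant $C=C_{k,r}$, depending only on $k$ and $r$, such that the following holds. For every graph $H$ on $r$ vertices, every positive integer $n$ and every balanced $k$-colouring $c\colon E(K_{nrk}) \to \{1,\dots,k\}$, there is an $H$-factor $F$ of $K_{nrk}$ such that $$\sum_{i=1}^k \left| |E(F)\cap c^{ -1}(i)| - \frac{|E(F)|}{k}\right| \leq C.$$ In particular, one may take $C = (8kr)^{(8kr)^k}$.
   Context: $K_N$ denotes the complete graph on $N$ vertices. An edge-colouring is balanced if each colour is used on exactly the same number of edges. For a graph $H$ on $r$ vertices, an $H$-factor of $K_{N}$ (with $r\mid N$) is a subgraph consisting of vertex-disjoint copies of $H$ which together cover all $N$ vertices. Colourings are arbitrary (not necessarily proper) functions on edges. -}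

module Defs where

open import Data.Fin using (Fin; _<_)
open import Data.Fin.Properties using (_≟_; _<?_)
open import Data.Integer using (+_)
open import Data.List using (List; allFin; concatMap; filter; length; mapMaybe)
import Data.Maybe as Maybe
open import Data.Nat using (ℕ; NonZero)
open import Data.Product using (_×_; _,_; ∃₂; ∃-syntax)
open import Data.Rational using (ℚ; ∣_∣; _-_; _/_)
open import Data.Rational.Properties using (+-0-commutativeMonoid)
open import Algebra.Properties.CommutativeMonoid.Sum +-0-commutativeMonoid
  using (sum-syntax)
open import Function.Bundles using (_↔_; _⇔_; module Inverse)
open import Level using (0ℓ)
open import Relation.Binary.Core using (Rel)
open import Relation.Binary.Definitions using (Symmetric; Decidable)
open import Relation.Binary.PropositionalEquality using (_≡_)
open import Relation.Nullary using (¬_; Dec)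
open import Relation.Nullary.Decidable using (dec⇒maybe; _×-dec_)

record SimpleGraph (n : ℕ) : Set₁ where
  field
    Adj       : Rel (Fin n) 0ℓ
    symmetric : Symmetric Adj
    loopless  : ∀ v → ¬ Adj v v
    adjacent? : Decidable Adj

open SimpleGraph

-- An edge of K_N is a two-element set of vertices, represented by its
-- increasing ordering. Proofs of u < v are unique, so a function on Edge N
-- is exactly a function on the edges of K_N.
Edge : ℕ → Set
Edge N = ∃₂ λ (u v : Fin N) → u < v

-- Each edge of K_N occurs exactly once in this list.
edges : ∀ N → List (Edge N)
edges N = concatMap
  (λ u → mapMaybe (λ v → Maybe.map (λ u<v → u , v , u<v) (dec⇒maybe (u <? v)))
                  (allFin N))
  (allFin N)

Colouring : ℕ → ℕ → Set
Colouring k N = Edge N → Fin k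

colourClassSize : ∀ {k N} → Colouring k N → Fin k → ℕ
colourClassSize {N = N} c i = length (filter (λ e → c e ≟ i) (edges N))

Balanced : ∀ {k N} → Colouring k N → Set
Balanced c = ∀ i j → colourClassSize c i ≡ colourClassSize c j

_∈E_ : ∀ {N} → Edge N → SimpleGraph N → Set
(u , v , _) ∈E F = Adj F u v

_∈E?_ : ∀ {N} (e : Edge N) (F : SimpleGraph N) → Dec (e ∈E F)
(u , v , _) ∈E? F = adjacent? F u v

edgeCount : ∀ {N} → SimpleGraph N → ℕ
edgeCount {N} F = length (filter (_∈E? F) (edges N))

-- |E(F) ∩ c⁻¹(i)|
edgeCountInColour : ∀ {k N} → SimpleGraph N → Colouring k N → Fin k → ℕ
edgeCountInColour {N = N} F c i =
  length (filter (λ e → (e ∈E? F) ×-dec (c e ≟ i)) (edges N))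

-- F is a spanning subgraph of K_N which is the union of copies of H; the
-- bijection sends (j , a) to the vertex playing the role of a in the j-th copy,
-- so the copies are vertex-disjoint and together cover all N vertices.
-- The number of copies is not prescribed: the bijection forces it to be N / r.
record IsFactor {r N : ℕ} (H : SimpleGraph r) (F : SimpleGraph N) : Set where
  field
    copies    : ℕ
    placement : (Fin copies × Fin r) ↔ Fin N

  vertex : Fin copies → Fin r → Fin N
  vertex j a = Inverse.to placement (j , a)

  field
    adjacency : ∀ u v → Adj F u v ⇔
      (∃[ j ] ∃[ a ] ∃[ b ] Adj H a b × vertex j a ≡ u × vertex j b ≡ v)

colourDeviation : ∀ {k N} .{{_ : NonZero k}} → SimpleGraph N → Colouring k N → ℚ
colourDeviation {k} F c =
  ∑[ i < k ] ∣ + edgeCountInColour F c i / 1 - + edgeCount F / k ∣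

-- Let yᵢ be the deviation of the i-th colour, and take a placement of the copies of H
-- such that no single move of the following kind decreases ∑ᵢ yᵢ²: r old copies are
-- rearranged into r new ones, each of which is transversal to the old ones. A uniformly
-- random move puts every edge of a new copy on a uniformly random pair of positions,
-- so by balancedness the average change of y is a negative multiple of y, up to a
-- bounded error.
-- Suppose y is large. By Dirichlet, there are a bounded s ≥ 1 and an integer vector p
-- such that s y / M is very close to p, where M = ∑ᵢ |yᵢ|. Since no move decreases
-- ∑ᵢ yᵢ², the change Δ of y under a move satisfies ⟨y , Δ⟩ ≥ -O(1); hence ⟨p , Δ⟩ > -1,
-- and ⟨p , Δ⟩ ≥ 0 as this is an integer. Averaging over all moves gives
-- ⟨p , y⟩ ≤ O(|p|), whereas ⟨p , y⟩ ≥ M |p| / 2s because p is nearly parallel to y.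
module Submission where

open import Defs
open import Data.Bool using (if_then_else_)
open import Data.Fin as Fin using (Fin; toℕ; fromℕ<; finToFun; funToFin)
import Data.Fin.Properties as Finₚ
open import Data.Integer using (ℤ; +_; -[1+_]; 0ℤ; 1ℤ; _+_; _-_; -_; ∣_∣; +≤+; +<+)
  renaming (_*_ to _⋆_; _≤_ to _≤ℤ_; _<_ to _<ℤ_)
import Data.Integer as ℤ
open import Data.Integer.DivMod using (_/ℕ_; _%ℕ_; n%ℕd<d; a≡a%ℕn+[a/ℕn]*n)
import Data.Integer.Properties as ℤₚ
open import Data.Integer.Tactic.RingSolver using (solve-∀)
open import Data.List using (List; []; _∷_; _++_; length; allFin; tabulate; cartesianProductWith; cartesianProduct;
  filter; concatMap; mapMaybe)
import Data.List as List
import Data.List.Properties as Listₚ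
open import Data.Maybe as Maybe using (Maybe; just; nothing; maybe′)
open import Data.Nat using (ℕ; zero; suc; NonZero; _*_; _^_; _≤_; z≤n; s≤s)
import Data.Nat as ℕ
open import Data.Nat.DivMod using (_%_; m%n<n; m≡m%n+[m/n]*n; m<n*o⇒m/o<n; %-distribˡ-+; [m+n]%n≡m%n; m<n⇒m%n≡m;
  m%n%n≡m%n)
open import Data.Nat.Induction using (<-wellFounded)
import Data.Nat.Properties as ℕₚ
open import Data.Product using (_×_; _,_; proj₁; proj₂; ∃; ∃-syntax; Σ-syntax)
import Data.Product.Properties as Productₚ
open import Data.Rational using (ℚ; _/_) renaming (_≤_ to _≤ℚ_)
import Data.Rational as ℚ
import Data.Rational.Properties as ℚₚ
open import Algebra.Properties.CommutativeMonoid.Sum ℚₚ.+-0-commutativeMonoid using (sum)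
open import Data.Rational.Unnormalised using (mkℚᵘ)
import Data.Rational.Unnormalised as ℚᵘ
import Data.Rational.Unnormalised.Properties as ℚᵘₚ
open import Data.Sum using (_⊎_; inj₁; inj₂)
open import Data.Vec using (Vec; []; _∷_; lookup)
open import Function using (_∘_; id; flip; it)
open import Function.Bundles using (_↔_; mk⇔; module Inverse; mk↔ₛ′)
open import Function.Construct.Composition using (_↔-∘_)
open import Function.Construct.Symmetry using (↔-sym)
open import Function.Definitions using (Injective)
open import Induction.WellFounded using (Acc; acc)
open import Relation.Binary.Definitions using (DecidableEquality; tri<; tri≈; tri>)
open import Relation.Binary.PropositionalEquality
open import Relation.Nullary using (¬_; Dec; yes; no; does; contradiction)
open import Relation.Nullary.Decidable using (_×-dec_; ¬?; map′; dec⇒maybe; dec-true; dec-false)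

-- The obstacle is one of scale. A random move shifts y on average by about -r² y / N, where N is
-- the number of vertices, whereas the quadratic term in the change of ∑ᵢ yᵢ² is bounded but does
-- not shrink with N. Averaging ∑ᵢ yᵢ² directly would therefore give only |y| = O(√N). Replacing y
-- by p turns the lossy bound -O(1) into exact nonnegativity for every move, so the drift has no
-- constant to overcome and N cancels. Moves are indexed by r independent uniformly random
-- positions, repetitions allowed, which makes every average a product of uniform sums. A tuple that
-- picks the same copy twice gives no move; this has probability O(1 / N), which is affordable
-- because the drift is of the same order.

⟦_⟧ : {P : Set} → Dec P → ℤ
⟦ P? ⟧ = if does P? then 1ℤ else 0ℤ

⟦⟧-yes : {P : Set} (P? : Dec P) → P → ⟦ P? ⟧ ≡ 1ℤ
⟦⟧-yes P? p rewrite dec-true P? p = refl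

⟦⟧-no : {P : Set} (P? : Dec P) → ¬ P → ⟦ P? ⟧ ≡ 0ℤ
⟦⟧-no P? ¬p rewrite dec-false P? ¬p = refl

⟦⟧-cong : {P Q : Set} (P? : Dec P) (Q? : Dec Q) → (P → Q) → (Q → P) → ⟦ P? ⟧ ≡ ⟦ Q? ⟧
⟦⟧-cong (yes p) Q? f g = sym (⟦⟧-yes Q? (f p))
⟦⟧-cong (no ¬p) Q? f g = sym (⟦⟧-no Q? (¬p ∘ g))

⟦⟧-× : {P Q : Set} (P? : Dec P) (Q? : Dec Q) → ⟦ P? ×-dec Q? ⟧ ≡ ⟦ P? ⟧ ⋆ ⟦ Q? ⟧
⟦⟧-× (yes _) Q? = sym (ℤₚ.*-identityˡ ⟦ Q? ⟧)
⟦⟧-× (no _)  Q? = refl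

0≤⟦⟧ : {P : Set} (P? : Dec P) → 0ℤ ≤ℤ ⟦ P? ⟧
0≤⟦⟧ (yes _) = +≤+ z≤n
0≤⟦⟧ (no _)  = +≤+ z≤n

⟦⟧≤1 : {P : Set} (P? : Dec P) → ⟦ P? ⟧ ≤ℤ 1ℤ
⟦⟧≤1 (yes _) = ℤₚ.≤-refl
⟦⟧≤1 (no _)  = +≤+ z≤n

-- Absolute values and inequalities of integers

∥_∥ : ℤ → ℤ
∥ i ∥ = + ∣ i ∣

0≤∥∥ : ∀ i → 0ℤ ≤ℤ ∥ i ∥
0≤∥∥ i = +≤+ z≤n

i≤∥i∥ : ∀ i → i ≤ℤ ∥ i ∥
i≤∥i∥ (+ n)    = ℤₚ.≤-refl
i≤∥i∥ -[1+ n ] = ℤ.-≤+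

∥-i∥ : ∀ i → ∥ - i ∥ ≡ ∥ i ∥
∥-i∥ i = cong +_ (ℤₚ.∣-i∣≡∣i∣ i)

-∥i∥≤i : ∀ i → - ∥ i ∥ ≤ℤ i
-∥i∥≤i i = subst₂ _≤ℤ_ (cong -_ (∥-i∥ i)) (ℤₚ.neg-involutive i) (ℤₚ.neg-mono-≤ (i≤∥i∥ (- i)))

∥i+j∥≤ : ∀ i j → ∥ i + j ∥ ≤ℤ ∥ i ∥ + ∥ j ∥
∥i+j∥≤ i j = +≤+ (ℤₚ.∣i+j∣≤∣i∣+∣j∣ i j)

∥i*j∥ : ∀ i j → ∥ i ⋆ j ∥ ≡ ∥ i ∥ ⋆ ∥ j ∥
∥i*j∥ i j = trans (cong +_ (ℤₚ.∣i*j∣≡∣i∣*∣j∣ i j)) (ℤₚ.pos-* ∣ i ∣ ∣ j ∣)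

∥i∥≤ : ∀ {i j} → i ≤ℤ j → - i ≤ℤ j → ∥ i ∥ ≤ℤ j
∥i∥≤ {i} i≤j -i≤j with ℤₚ.+∣i∣≡i⊎+∣i∣≡-i i
... | inj₁ eq = subst (_≤ℤ _) (sym eq) i≤j
... | inj₂ eq = subst (_≤ℤ _) (sym eq) -i≤j

∥i∥∥i∥≡i*i : ∀ i → ∥ i ∥ ⋆ ∥ i ∥ ≡ i ⋆ i
∥i∥∥i∥≡i*i (+ n)    = refl
∥i∥∥i∥≡i*i -[1+ n ] = refl

0≤i*i : ∀ i → 0ℤ ≤ℤ i ⋆ i
0≤i*i i = subst (0ℤ ≤ℤ_) (trans (∥i*j∥ i i) (∥i∥∥i∥≡i*i i)) (0≤∥∥ (i ⋆ i))

*-monoˡ : ∀ {i j l} → 0ℤ ≤ℤ l → i ≤ℤ j → l ⋆ i ≤ℤ l ⋆ j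
*-monoˡ {l = l} 0≤l = ℤₚ.*-monoˡ-≤-nonNeg l {{ℤ.nonNegative 0≤l}}

*-monoʳ : ∀ {i j l} → 0ℤ ≤ℤ l → i ≤ℤ j → i ⋆ l ≤ℤ j ⋆ l
*-monoʳ {l = l} 0≤l = ℤₚ.*-monoʳ-≤-nonNeg l {{ℤ.nonNegative 0≤l}}

*-nonNeg : ∀ {i j} → 0ℤ ≤ℤ i → 0ℤ ≤ℤ j → 0ℤ ≤ℤ i ⋆ j
*-nonNeg {i} {j} 0≤i 0≤j = subst (_≤ℤ i ⋆ j) (ℤₚ.*-zeroʳ i) (*-monoˡ 0≤i 0≤j)

*-mono-nonNeg : ∀ {a b c d} → 0ℤ ≤ℤ b → 0ℤ ≤ℤ c → a ≤ℤ b → c ≤ℤ d → a ⋆ c ≤ℤ b ⋆ d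
*-mono-nonNeg 0≤b 0≤c a≤b c≤d = ℤₚ.≤-trans (*-monoʳ 0≤c a≤b) (*-monoˡ 0≤b c≤d)

-- Linear inequalities are proved by exhibiting j - i as a combination of
-- nonnegative terms; the equation is left to the ring solver.
≤-by : ∀ {i j} d → 0ℤ ≤ℤ d → j - i ≡ d → i ≤ℤ j
≤-by d 0≤d eq = ℤₚ.0≤i-j⇒j≤i (subst (0ℤ ≤ℤ_) (sym eq) 0≤d)

-- Finite sums of integers

∑ : {A : Set} → List A → (A → ℤ) → ℤ
∑ []       f = 0ℤ
∑ (x ∷ xs) f = f x + ∑ xs f

syntax ∑ xs (λ x → e) = ∑[ x ← xs ] e

module _ {A : Set} where

  ∑-cong : (xs : List A) {f g : A → ℤ} → (∀ x → f x ≡ g x) → ∑ xs f ≡ ∑ xs g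
  ∑-cong []       eq = refl
  ∑-cong (x ∷ xs) eq = cong₂ _+_ (eq x) (∑-cong xs eq)

  ∑-mono : (xs : List A) {f g : A → ℤ} → (∀ x → f x ≤ℤ g x) → ∑ xs f ≤ℤ ∑ xs g
  ∑-mono []       le = ℤₚ.≤-refl
  ∑-mono (x ∷ xs) le = ℤₚ.+-mono-≤ (le x) (∑-mono xs le)

  ∑-+ : (xs : List A) (f g : A → ℤ) → ∑ xs (λ x → f x + g x) ≡ ∑ xs f + ∑ xs g
  ∑-+ []       f g = refl
  ∑-+ (x ∷ xs) f g = trans (cong (_+_ (f x + g x)) (∑-+ xs f g)) (swap (f x) (g x) (∑ xs f) (∑ xs g))
    where
    swap : ∀ a b c d → a + b + (c + d) ≡ a + c + (b + d)
    swap = solve-∀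

  ∑-*ˡ : (xs : List A) (c : ℤ) (f : A → ℤ) → ∑ xs (λ x → c ⋆ f x) ≡ c ⋆ ∑ xs f
  ∑-*ˡ []       c f = sym (ℤₚ.*-zeroʳ c)
  ∑-*ˡ (x ∷ xs) c f = trans (cong (_+_ (c ⋆ f x)) (∑-*ˡ xs c f)) (sym (ℤₚ.*-distribˡ-+ c (f x) (∑ xs f)))

  ∑-*ʳ : (xs : List A) (c : ℤ) (f : A → ℤ) → ∑ xs (λ x → f x ⋆ c) ≡ ∑ xs f ⋆ c
  ∑-*ʳ xs c f = trans (∑-cong xs (λ x → ℤₚ.*-comm (f x) c)) (trans (∑-*ˡ xs c f) (ℤₚ.*-comm c (∑ xs f)))

  ∑-neg : (xs : List A) (f : A → ℤ) → ∑ xs (λ x → - f x) ≡ - ∑ xs f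
  ∑-neg []       f = refl
  ∑-neg (x ∷ xs) f = trans (cong (_+_ (- f x)) (∑-neg xs f)) (sym (ℤₚ.neg-distrib-+ (f x) (∑ xs f)))

  ∑-minus : (xs : List A) (f g : A → ℤ) → ∑ xs (λ x → f x - g x) ≡ ∑ xs f - ∑ xs g
  ∑-minus xs f g = trans (∑-+ xs f (-_ ∘ g)) (cong (_+_ (∑ xs f)) (∑-neg xs g))

  ∑-const : (xs : List A) (c : ℤ) → ∑ xs (λ _ → c) ≡ + length xs ⋆ c
  ∑-const []       c = refl
  ∑-const (x ∷ xs) c = trans (cong (_+_ c) (∑-const xs c)) (sym (ℤₚ.suc-* (+ length xs) c))

  ∑-zero : (xs : List A) {f : A → ℤ} → (∀ x → f x ≡ 0ℤ) → ∑ xs f ≡ 0ℤ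
  ∑-zero xs eq = trans (∑-cong xs eq) (trans (∑-const xs 0ℤ) (ℤₚ.*-zeroʳ (+ length xs)))

  ∑-nonNeg : (xs : List A) {f : A → ℤ} → (∀ x → 0ℤ ≤ℤ f x) → 0ℤ ≤ℤ ∑ xs f
  ∑-nonNeg []       le = ℤₚ.≤-refl
  ∑-nonNeg (x ∷ xs) le = ℤₚ.+-mono-≤ (le x) (∑-nonNeg xs le)

  ∑-≤-const : (xs : List A) {f : A → ℤ} (c : ℤ) → (∀ x → f x ≤ℤ c) → ∑ xs f ≤ℤ + length xs ⋆ c
  ∑-≤-const xs c le = subst (_ ≤ℤ_) (∑-const xs c) (∑-mono xs le)

  ∥∑∥≤ : (xs : List A) (f : A → ℤ) → ∥ ∑ xs f ∥ ≤ℤ ∑[ x ← xs ] ∥ f x ∥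
  ∥∑∥≤ []       f = ℤₚ.≤-refl
  ∥∑∥≤ (x ∷ xs) f = ℤₚ.≤-trans (∥i+j∥≤ (f x) (∑ xs f)) (ℤₚ.+-monoʳ-≤ ∥ f x ∥ (∥∑∥≤ xs f))

  ∑-++ : (xs ys : List A) (f : A → ℤ) → ∑ (xs ++ ys) f ≡ ∑ xs f + ∑ ys f
  ∑-++ []       ys f = sym (ℤₚ.+-identityˡ (∑ ys f))
  ∑-++ (x ∷ xs) ys f = trans (cong (_+_ (f x)) (∑-++ xs ys f)) (sym (ℤₚ.+-assoc (f x) (∑ xs f) (∑ ys f)))

  ∑-map : {B : Set} (g : B → A) (xs : List B) (f : A → ℤ) → ∑ (List.map g xs) f ≡ ∑ xs (f ∘ g)
  ∑-map g []       f = refl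
  ∑-map g (x ∷ xs) f = cong (_+_ (f (g x))) (∑-map g xs f)

∑-comm : {A B : Set} (xs : List A) (ys : List B) (f : A → B → ℤ) →
         ∑[ x ← xs ] ∑[ y ← ys ] f x y ≡ ∑[ y ← ys ] ∑[ x ← xs ] f x y
∑-comm []       ys f = sym (∑-zero ys (λ _ → refl))
∑-comm (x ∷ xs) ys f = trans (cong (_+_ (∑ ys (f x))) (∑-comm xs ys f))
                             (sym (∑-+ ys (f x) (λ y → ∑[ x ← xs ] f x y)))

∑-cartesian : {A B C : Set} (c : A → B → C) (xs : List A) (ys : List B) (f : C → ℤ) →
              ∑ (cartesianProductWith c xs ys) f ≡ ∑[ x ← xs ] ∑[ y ← ys ] f (c x y)
∑-cartesian c []       ys f = refl
∑-cartesian c (x ∷ xs) ys f = trans (∑-++ (List.map (c x) ys) (cartesianProductWith c xs ys) f)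
  (cong₂ _+_ (∑-map (c x) ys f) (∑-cartesian c xs ys f))

∑-tabulate : ∀ {A : Set} {n} (g : Fin n → A) (f : A → ℤ) → ∑ (tabulate g) f ≡ ∑ (allFin n) (f ∘ g)
∑-tabulate {n = zero}  g f = refl
∑-tabulate {n = suc n} g f = cong (_+_ (f (g Fin.zero)))
  (trans (∑-tabulate (g ∘ Fin.suc) f) (sym (∑-tabulate Fin.suc (f ∘ g))))

-- The list xs contains every element of A exactly once.
Enumerates : {A : Set} → DecidableEquality A → List A → Set
Enumerates {A} _≟_ xs = ∀ (a : A) (f : A → ℤ) → ∑[ x ← xs ] (⟦ x ≟ a ⟧ ⋆ f x) ≡ f a

allFin-enumerates : ∀ n → Enumerates Finₚ._≟_ (allFin n)
allFin-enumerates (suc n) Fin.zero f = begin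
  1ℤ ⋆ f Fin.zero + ∑ (tabulate Fin.suc) (λ x → ⟦ x Finₚ.≟ Fin.zero ⟧ ⋆ f x)
    ≡⟨ cong₂ _+_ (ℤₚ.*-identityˡ (f Fin.zero)) (trans (∑-tabulate {n = n} Fin.suc _) (∑-zero (allFin n) (λ _ → refl))) ⟩
  f Fin.zero + 0ℤ
    ≡⟨ ℤₚ.+-identityʳ (f Fin.zero) ⟩
  f Fin.zero ∎
  where open ≡-Reasoning
allFin-enumerates (suc n) (Fin.suc a) f = begin
  0ℤ + ∑ (tabulate Fin.suc) (λ x → ⟦ x Finₚ.≟ Fin.suc a ⟧ ⋆ f x)
    ≡⟨ ℤₚ.+-identityˡ (∑ (tabulate Fin.suc) (λ x → ⟦ x Finₚ.≟ Fin.suc a ⟧ ⋆ f x)) ⟩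
  ∑ (tabulate Fin.suc) (λ x → ⟦ x Finₚ.≟ Fin.suc a ⟧ ⋆ f x)
    ≡⟨ ∑-tabulate {n = n} Fin.suc _ ⟩
  ∑ (allFin n) (λ x → ⟦ Fin.suc x Finₚ.≟ Fin.suc a ⟧ ⋆ f (Fin.suc x))
    ≡⟨ ∑-cong (allFin n) (λ x → cong (_⋆ f (Fin.suc x)) (⟦⟧-cong (Fin.suc x Finₚ.≟ Fin.suc a) (x Finₚ.≟ a) Finₚ.suc-injective (cong Fin.suc))) ⟩
  ∑ (allFin n) (λ x → ⟦ x Finₚ.≟ a ⟧ ⋆ f (Fin.suc x))
    ≡⟨ allFin-enumerates n a (f ∘ Fin.suc) ⟩
  f (Fin.suc a) ∎
  where open ≡-Reasoning

-- Each `f b` is multiplied by a sum of indicators of `a ≡ from b`, which is 1. After exchanging the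
-- sums, the same indicator is read as `b ≡ to a` and singles out `b` instead.
∑-reindex : {A B : Set} (_≟A_ : DecidableEquality A) (_≟B_ : DecidableEquality B)
            (xs : List A) (ys : List B) → Enumerates _≟A_ xs → Enumerates _≟B_ ys →
            (to : A → B) (from : B → A) → (∀ b → to (from b) ≡ b) → (∀ a → from (to a) ≡ a) →
            (f : B → ℤ) → ∑ xs (f ∘ to) ≡ ∑ ys f
∑-reindex _≟A_ _≟B_ xs ys enumA enumB to from to-from from-to f = sym (begin
  ∑ ys f
    ≡⟨ ∑-cong ys (λ b → sym (enumA (from b) (λ _ → f b))) ⟩
  ∑[ b ← ys ] ∑[ a ← xs ] (⟦ a ≟A from b ⟧ ⋆ f b)
    ≡⟨ ∑-comm ys xs _ ⟩
  ∑[ a ← xs ] ∑[ b ← ys ] (⟦ a ≟A from b ⟧ ⋆ f b)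
    ≡⟨ ∑-cong xs (λ a → ∑-cong ys (λ b → cong (_⋆ f b)
         (⟦⟧-cong (a ≟A from b) (b ≟B to a)
            (λ { refl → sym (to-from b) }) (λ { refl → sym (from-to a) })))) ⟩
  ∑[ a ← xs ] ∑[ b ← ys ] (⟦ b ≟B to a ⟧ ⋆ f b)
    ≡⟨ ∑-cong xs (λ a → enumB (to a) f) ⟩
  ∑ xs (f ∘ to) ∎)
  where open ≡-Reasoning

-- Sums over all n-tuples

tuples : {A : Set} → List A → ∀ n → List (Vec A n)
tuples xs zero    = [] ∷ []
tuples xs (suc n) = cartesianProductWith _∷_ xs (tuples xs n)

module _ {A : Set} (xs : List A) where

  private
    q : ℤ
    q = + length xs

    #tuples : ℕ → ℤ
    #tuples n = + length (tuples xs n)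

  #tuples-suc : ∀ n → #tuples (suc n) ≡ q ⋆ #tuples n
  #tuples-suc n = begin
    #tuples (suc n)                          ≡⟨ sym (trans (∑-const (tuples xs (suc n)) 1ℤ) (ℤₚ.*-identityʳ _)) ⟩
    ∑ (tuples xs (suc n)) (λ _ → 1ℤ)         ≡⟨ ∑-cartesian _∷_ xs (tuples xs n) (λ _ → 1ℤ) ⟩
    ∑ xs (λ _ → ∑ (tuples xs n) (λ _ → 1ℤ))  ≡⟨ ∑-const xs _ ⟩
    q ⋆ ∑ (tuples xs n) (λ _ → 1ℤ)           ≡⟨ cong (q ⋆_) (trans (∑-const (tuples xs n) 1ℤ) (ℤₚ.*-identityʳ _)) ⟩
    q ⋆ #tuples n                            ∎
    where open ≡-Reasoning

  #tuples-pos : 0ℤ <ℤ q → ∀ n → 0ℤ <ℤ #tuples n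
  #tuples-pos 0<q zero    = +<+ (s≤s z≤n)
  #tuples-pos 0<q (suc n) = subst (0ℤ <ℤ_) (sym (#tuples-suc n))
    (subst (_<ℤ q ⋆ #tuples n) (ℤₚ.*-zeroʳ q) (ℤₚ.*-monoˡ-<-pos q {{ℤ.positive 0<q}} (#tuples-pos 0<q n)))

  -- One coordinate of a uniformly random tuple is uniform; the denominators are cleared.
  ∑-tuples-lookup : ∀ n (u : Fin n) (f : A → ℤ) →
                    q ⋆ ∑[ g ← tuples xs n ] f (lookup g u) ≡ #tuples n ⋆ ∑ xs f
  ∑-tuples-lookup (suc n) Fin.zero f = begin
    q ⋆ ∑ (tuples xs (suc n)) (λ g → f (lookup g Fin.zero))
      ≡⟨ cong (q ⋆_) (∑-cartesian _∷_ xs (tuples xs n) _) ⟩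
    q ⋆ ∑ xs (λ x → ∑ (tuples xs n) (λ _ → f x))
      ≡⟨ cong (q ⋆_) (trans (∑-cong xs (λ x → ∑-const (tuples xs n) (f x))) (∑-*ˡ xs (#tuples n) f)) ⟩
    q ⋆ (#tuples n ⋆ ∑ xs f)
      ≡⟨ sym (ℤₚ.*-assoc q (#tuples n) (∑ xs f)) ⟩
    q ⋆ #tuples n ⋆ ∑ xs f
      ≡⟨ cong (_⋆ ∑ xs f) (sym (#tuples-suc n)) ⟩
    #tuples (suc n) ⋆ ∑ xs f ∎
    where open ≡-Reasoning
  ∑-tuples-lookup (suc n) (Fin.suc u) f = begin
    q ⋆ ∑ (tuples xs (suc n)) (λ g → f (lookup g (Fin.suc u)))
      ≡⟨ cong (q ⋆_) (∑-cartesian _∷_ xs (tuples xs n) _) ⟩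
    q ⋆ ∑ xs (λ _ → ∑ (tuples xs n) (λ g → f (lookup g u)))
      ≡⟨ cong (q ⋆_) (∑-const xs _) ⟩
    q ⋆ (q ⋆ ∑ (tuples xs n) (λ g → f (lookup g u)))
      ≡⟨ cong (q ⋆_) (∑-tuples-lookup n u f) ⟩
    q ⋆ (#tuples n ⋆ ∑ xs f)
      ≡⟨ sym (ℤₚ.*-assoc q (#tuples n) (∑ xs f)) ⟩
    q ⋆ #tuples n ⋆ ∑ xs f
      ≡⟨ cong (_⋆ ∑ xs f) (sym (#tuples-suc n)) ⟩
    #tuples (suc n) ⋆ ∑ xs f ∎
    where open ≡-Reasoning

  -- Two different coordinates of a uniformly random tuple are independent and uniform.
  ∑-tuples-lookup₂ : ∀ n {u v : Fin n} → u ≢ v → (f : A → A → ℤ) →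
                     q ⋆ q ⋆ ∑[ g ← tuples xs n ] f (lookup g u) (lookup g v)
                     ≡ #tuples n ⋆ ∑[ x ← xs ] ∑[ y ← xs ] f x y
  ∑-tuples-lookup₂ (suc n) {Fin.zero} {Fin.zero} u≢v f = contradiction refl u≢v
  ∑-tuples-lookup₂ (suc n) {Fin.zero} {Fin.suc v} _ f = begin
    q ⋆ q ⋆ ∑ (tuples xs (suc n)) (λ g → f (lookup g Fin.zero) (lookup g (Fin.suc v)))
      ≡⟨ cong (q ⋆ q ⋆_) (∑-cartesian _∷_ xs (tuples xs n) _) ⟩
    q ⋆ q ⋆ ∑ xs (λ x → ∑ (tuples xs n) (λ g → f x (lookup g v)))
      ≡⟨ ℤₚ.*-assoc q q _ ⟩
    q ⋆ (q ⋆ ∑ xs (λ x → ∑ (tuples xs n) (λ g → f x (lookup g v))))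
      ≡⟨ cong (q ⋆_) (sym (∑-*ˡ xs q _)) ⟩
    q ⋆ ∑ xs (λ x → q ⋆ ∑ (tuples xs n) (λ g → f x (lookup g v)))
      ≡⟨ cong (q ⋆_) (∑-cong xs (λ x → ∑-tuples-lookup n v (f x))) ⟩
    q ⋆ ∑ xs (λ x → #tuples n ⋆ ∑ xs (f x))
      ≡⟨ cong (q ⋆_) (∑-*ˡ xs (#tuples n) _) ⟩
    q ⋆ (#tuples n ⋆ ∑ xs (λ x → ∑ xs (f x)))
      ≡⟨ sym (ℤₚ.*-assoc q (#tuples n) _) ⟩
    q ⋆ #tuples n ⋆ ∑ xs (λ x → ∑ xs (f x))
      ≡⟨ cong (_⋆ ∑ xs (λ x → ∑ xs (f x))) (sym (#tuples-suc n)) ⟩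
    #tuples (suc n) ⋆ ∑ xs (λ x → ∑ xs (f x)) ∎
    where open ≡-Reasoning
  ∑-tuples-lookup₂ (suc n) {Fin.suc u} {Fin.zero} u≢v f =
    trans (∑-tuples-lookup₂ (suc n) {Fin.zero} {Fin.suc u} (λ ()) (flip f))
          (cong (#tuples (suc n) ⋆_) (∑-comm xs xs (flip f)))
  ∑-tuples-lookup₂ (suc n) {Fin.suc u} {Fin.suc v} u≢v f = begin
    q ⋆ q ⋆ ∑ (tuples xs (suc n)) (λ g → f (lookup g (Fin.suc u)) (lookup g (Fin.suc v)))
      ≡⟨ cong (q ⋆ q ⋆_) (trans (∑-cartesian _∷_ xs (tuples xs n) _) (∑-const xs _)) ⟩
    q ⋆ q ⋆ (q ⋆ S)
      ≡⟨ trans (ℤₚ.*-assoc q q (q ⋆ S)) (cong (q ⋆_) (sym (ℤₚ.*-assoc q q S))) ⟩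
    q ⋆ (q ⋆ q ⋆ S)
      ≡⟨ cong (q ⋆_) (∑-tuples-lookup₂ n (u≢v ∘ cong Fin.suc) f) ⟩
    q ⋆ (#tuples n ⋆ ∑ xs (λ x → ∑ xs (f x)))
      ≡⟨ sym (ℤₚ.*-assoc q (#tuples n) _) ⟩
    q ⋆ #tuples n ⋆ ∑ xs (λ x → ∑ xs (f x))
      ≡⟨ cong (_⋆ ∑ xs (λ x → ∑ xs (f x))) (sym (#tuples-suc n)) ⟩
    #tuples (suc n) ⋆ ∑ xs (λ x → ∑ xs (f x)) ∎
    where
    open ≡-Reasoning
    S = ∑ (tuples xs n) (λ g → f (lookup g u) (lookup g v))

-- Simultaneous Diophantine approximation

∣i-j∣<m : ∀ {i j m} → i ℕ.< m → j ℕ.< m → ∥ + i - + j ∥ <ℤ + m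
∣i-j∣<m {i} {j} i<m j<m rewrite ℤₚ.m-n≡m⊖n i j =
  +<+ (ℕₚ.≤-<-trans (ℤₚ.∣m⊝n∣≤m⊔n i j) (ℕₚ.⊔-lub i<m j<m))

/-≡⇒∣i-j∣< : ∀ a b m .{{_ : NonZero m}} → a ℕ./ m ≡ b ℕ./ m → ∥ + a - + b ∥ <ℤ + m
/-≡⇒∣i-j∣< a b m eq = subst (λ z → ∥ z ∥ <ℤ + m) (sym diff) (∣i-j∣<m (m%n<n a m) (m%n<n b m))
  where
  expand : ∀ c → + c ≡ + (c % m) + + (c ℕ./ m) ⋆ + m
  expand c = trans (cong +_ (m≡m%n+[m/n]*n c m))
    (trans (ℤₚ.pos-+ (c % m) _) (cong (_+_ (+ (c % m))) (ℤₚ.pos-* (c ℕ./ m) m)))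
  cancel : ∀ u v w → (u + w) - (v + w) ≡ u - v
  cancel = solve-∀
  diff : + a - + b ≡ + (a % m) - + (b % m)
  diff = begin
    + a - + b
      ≡⟨ cong₂ _-_ (expand a) (expand b) ⟩
    (+ (a % m) + + (a ℕ./ m) ⋆ + m) - (+ (b % m) + + (b ℕ./ m) ⋆ + m)
      ≡⟨ cong (λ z → (+ (a % m) + + z ⋆ + m) - (+ (b % m) + + (b ℕ./ m) ⋆ + m)) eq ⟩
    (+ (a % m) + + (b ℕ./ m) ⋆ + m) - (+ (b % m) + + (b ℕ./ m) ⋆ + m)
      ≡⟨ cancel (+ (a % m)) (+ (b % m)) (+ (b ℕ./ m) ⋆ + m) ⟩
    + (a % m) - + (b % m) ∎
    where open ≡-Reasoning

-- Dirichlet's simultaneous approximation theorem for the vector y / M.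
module _ (k Q M : ℕ) .{{_ : NonZero Q}} .{{_ : NonZero M}} (y : Fin k → ℤ) where

  private
    -- `rem t i` / M is the fractional part of t yᵢ / M, and `quo-scaled t i` is the index of the
    -- interval of length 1 / Q that contains it.
    rem quo-scaled : ℕ → Fin k → ℕ
    rem t i = (+ t ⋆ y i) %ℕ M
    quo-scaled t i = (Q * rem t i) ℕ./ M

    bucket : ℕ → Fin k → Fin Q
    bucket t i = fromℕ< {quo-scaled t i} (m<n*o⇒m/o<n (ℕₚ.*-monoʳ-< Q (n%ℕd<d (+ t ⋆ y i) M)))

    -- The multipliers 0, ..., Q ^ k outnumber the boxes by one. Starting from 0 keeps the
    -- difference of two of them at most Q ^ k.
    buckets : Fin (suc (Q ^ k)) → Fin (Q ^ k)
    buckets t = funToFin (bucket (toℕ t))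

  dirichlet : ∃[ s ] Σ[ p ∈ (Fin k → ℤ) ] (1 ≤ s × s ≤ Q ^ k ×
                (∀ i → + Q ⋆ ∥ + s ⋆ y i - + M ⋆ p i ∥ <ℤ + M))
  dirichlet with Finₚ.pigeonhole (ℕₚ.n<1+n (Q ^ k)) buckets
  ... | i₁ , i₂ , t₁<t₂ , eq =
    t₂ ℕ.∸ t₁ , p , ℕₚ.m<n⇒0<n∸m t₁<t₂ , ℕₚ.≤-trans (ℕₚ.m∸n≤m t₂ t₁) (ℕₚ.≤-pred (Finₚ.toℕ<n i₂)) , close
    where
    t₁ t₂ : ℕ
    t₁ = toℕ i₁
    t₂ = toℕ i₂

    -- The difference of the two integer parts, so that the error becomes a difference of two
    -- remainders.
    p : Fin k → ℤ
    p i = (+ t₂ ⋆ y i) /ℕ M - (+ t₁ ⋆ y i) /ℕ M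

    same-bucket : ∀ i → quo-scaled t₂ i ≡ quo-scaled t₁ i
    same-bucket i = sym (begin
      quo-scaled t₁ i                ≡⟨ sym (Finₚ.toℕ-fromℕ< _) ⟩
      toℕ (bucket t₁ i)              ≡⟨ cong toℕ (sym (Finₚ.finToFun-funToFin (bucket t₁) i)) ⟩
      toℕ (finToFun (buckets i₁) i)  ≡⟨ cong (λ b → toℕ (finToFun b i)) eq ⟩
      toℕ (finToFun (buckets i₂) i)  ≡⟨ cong toℕ (Finₚ.finToFun-funToFin (bucket t₂) i) ⟩
      toℕ (bucket t₂ i)              ≡⟨ Finₚ.toℕ-fromℕ< _ ⟩
      quo-scaled t₂ i                ∎)
      where open ≡-Reasoning

    error : ∀ i → + (t₂ ℕ.∸ t₁) ⋆ y i - + M ⋆ p i ≡ + rem t₂ i - + rem t₁ i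
    error i = begin
      + (t₂ ℕ.∸ t₁) ⋆ y i - + M ⋆ p i
        ≡⟨ cong (λ z → z ⋆ y i - + M ⋆ p i)
             (sym (trans (ℤₚ.m-n≡m⊖n t₂ t₁) (ℤₚ.⊖-≥ (ℕₚ.<⇒≤ t₁<t₂)))) ⟩
      (+ t₂ - + t₁) ⋆ y i - + M ⋆ p i
        ≡⟨ split (+ t₂) (+ t₁) (y i) (+ M ⋆ p i) ⟩
      + t₂ ⋆ y i - + t₁ ⋆ y i - + M ⋆ p i
        ≡⟨ cong₂ (λ a b → a - b - + M ⋆ p i) (a≡a%ℕn+[a/ℕn]*n (+ t₂ ⋆ y i) M) (a≡a%ℕn+[a/ℕn]*n (+ t₁ ⋆ y i) M) ⟩
      (+ rem t₂ i + (+ t₂ ⋆ y i) /ℕ M ⋆ + M) - (+ rem t₁ i + (+ t₁ ⋆ y i) /ℕ M ⋆ + M) - + M ⋆ p i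
        ≡⟨ cancel (+ rem t₂ i) (+ rem t₁ i) ((+ t₂ ⋆ y i) /ℕ M) ((+ t₁ ⋆ y i) /ℕ M) (+ M) ⟩
      + rem t₂ i - + rem t₁ i ∎
      where
      open ≡-Reasoning
      split : ∀ a b c d → (a - b) ⋆ c - d ≡ a ⋆ c - b ⋆ c - d
      split = solve-∀
      cancel : ∀ a b c d m → (a + c ⋆ m) - (b + d ⋆ m) - m ⋆ (c - d) ≡ a - b
      cancel = solve-∀

    close : ∀ i → + Q ⋆ ∥ + (t₂ ℕ.∸ t₁) ⋆ y i - + M ⋆ p i ∥ <ℤ + M
    close i = subst (_<ℤ + M) (sym eq′)
      (/-≡⇒∣i-j∣< (Q * rem t₂ i) (Q * rem t₁ i) M (same-bucket i))
      where
      open ≡-Reasoning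
      distrib : ∀ a b c → a ⋆ (b - c) ≡ a ⋆ b - a ⋆ c
      distrib = solve-∀
      eq′ : + Q ⋆ ∥ + (t₂ ℕ.∸ t₁) ⋆ y i - + M ⋆ p i ∥ ≡ ∥ + (Q * rem t₂ i) - + (Q * rem t₁ i) ∥
      eq′ = begin
        + Q ⋆ ∥ + (t₂ ℕ.∸ t₁) ⋆ y i - + M ⋆ p i ∥  ≡⟨ cong (λ z → + Q ⋆ ∥ z ∥) (error i) ⟩
        + Q ⋆ ∥ + rem t₂ i - + rem t₁ i ∥          ≡⟨ sym (∥i*j∥ (+ Q) _) ⟩
        ∥ + Q ⋆ (+ rem t₂ i - + rem t₁ i) ∥        ≡⟨ cong ∥_∥ (distrib (+ Q) (+ rem t₂ i) (+ rem t₁ i)) ⟩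
        ∥ + Q ⋆ + rem t₂ i - + Q ⋆ + rem t₁ i ∥    ≡⟨ cong₂ (λ a b → ∥ a - b ∥) (sym (ℤₚ.pos-* Q (rem t₂ i))) (sym (ℤₚ.pos-* Q (rem t₁ i))) ⟩
        ∥ + (Q * rem t₂ i) - + (Q * rem t₁ i) ∥    ∎

-- Rounding to an integer vector

∥i∥≤i*i : ∀ i → ∥ i ∥ ≤ℤ i ⋆ i
∥i∥≤i*i i = subst (∥ i ∥ ≤ℤ_) (trans (ℤₚ.pos-* ∣ i ∣ ∣ i ∣) (∥i∥∥i∥≡i*i i)) (+≤+ (n≤n*n ∣ i ∣))
  where
  n≤n*n : ∀ n → n ≤ n * n
  n≤n*n zero    = z≤n
  n≤n*n (suc n) = ℕₚ.m≤m*n (suc n) (suc n)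

0≤∥i∥+i : ∀ i → 0ℤ ≤ℤ ∥ i ∥ + i
0≤∥i∥+i i = ≤-by (i - - ∥ i ∥) (ℤₚ.i≤j⇒0≤j-i (-∥i∥≤i i)) (rearrange ∥ i ∥ i)
  where
  rearrange : ∀ n i → n + i - 0ℤ ≡ i - - n
  rearrange = solve-∀

-- In particular p and y have the same sign when p is the integer nearest to s y / M.
nearest-pairing : ∀ {M s} y p → 0ℤ ≤ℤ M → + 2 ⋆ ∥ s ⋆ y - M ⋆ p ∥ ≤ℤ M →
                  M ⋆ ∥ p ∥ ≤ℤ + 2 ⋆ s ⋆ (p ⋆ y)
-- With s y = M p + ε the right-hand side is 2 M p² + 2 ε p. Here p² ≥ |p| by integrality, and 2 |ε|
-- ≤ M costs at most M |p| of the 2 M |p|.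
nearest-pairing {M} {s} y p 0≤M close = ≤-by
  (+ 2 ⋆ M ⋆ (p ⋆ p - ∥ p ∥) + (M - + 2 ⋆ ∥ ε ∥) ⋆ ∥ p ∥ + + 2 ⋆ (∥ ε ∥ ⋆ ∥ p ∥ + ε ⋆ p))
  (ℤₚ.+-mono-≤ (ℤₚ.+-mono-≤
     (*-nonNeg (*-nonNeg {+ 2} (+≤+ z≤n) 0≤M) (ℤₚ.i≤j⇒0≤j-i (∥i∥≤i*i p)))
     (*-nonNeg (ℤₚ.i≤j⇒0≤j-i close) (0≤∥∥ p)))
     (*-nonNeg {+ 2} (+≤+ z≤n) (subst (λ z → 0ℤ ≤ℤ z + ε ⋆ p) (∥i*j∥ ε p) (0≤∥i∥+i (ε ⋆ p)))))
  (identity M s y p ∥ p ∥ ∥ ε ∥)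
  where
  ε = s ⋆ y - M ⋆ p
  identity : ∀ M s y p n e →
    + 2 ⋆ s ⋆ (p ⋆ y) - M ⋆ n ≡
    + 2 ⋆ M ⋆ (p ⋆ p - n) + (M - + 2 ⋆ e) ⋆ n + + 2 ⋆ (e ⋆ n + (s ⋆ y - M ⋆ p) ⋆ p)
  identity = solve-∀

module _ {A : Set} (xs : List A) (y p : A → ℤ) {M s : ℤ} where

  private
    K : ℤ
    K = + length xs

    ε : A → ℤ
    ε i = s ⋆ y i - M ⋆ p i

  -- If p were zero, then ε would equal s y. But K entries below M / K sum to less than M, while ∑ s
  -- |yᵢ| = s M ≥ M.
  rounding-nonzero : 0ℤ <ℤ K → 1ℤ ≤ℤ s → M ≡ ∑[ i ← xs ] ∥ y i ∥ → 0ℤ ≤ℤ M →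
                     (∀ i → K ⋆ ∥ ε i ∥ <ℤ M) → 0ℤ <ℤ ∑[ i ← xs ] ∥ p i ∥
  rounding-nonzero 0<K 1≤s M≡ 0≤M close with 0ℤ ℤₚ.<? ∑ xs (λ i → ∥ p i ∥)
  ... | yes 0<P = 0<P
  ... | no  0≮P = contradiction impossible λ ()
    where
    P E : ℤ
    P = ∑[ i ← xs ] ∥ p i ∥
    E = ∑[ i ← xs ] ∥ ε i ∥

    -- Strictness is a spare 1 in each of the K terms, and one of these units survives the division
    -- by K.
    E<M : E + 1ℤ ≤ℤ M
    E<M = ℤₚ.*-cancelˡ-≤-pos (E + 1ℤ) M K {{ℤ.positive 0<K}} (begin
      K ⋆ (E + 1ℤ)                     ≡⟨ ℤₚ.*-distribˡ-+ K E 1ℤ ⟩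
      K ⋆ E + K ⋆ 1ℤ                   ≡⟨ cong₂ _+_ (sym (∑-*ˡ xs K _)) (sym (∑-const xs 1ℤ)) ⟩
      ∑ xs (λ i → K ⋆ ∥ ε i ∥) + ∑ xs (λ _ → 1ℤ)  ≡⟨ sym (∑-+ xs _ _) ⟩
      ∑ xs (λ i → K ⋆ ∥ ε i ∥ + 1ℤ)    ≤⟨ ∑-≤-const xs M (λ i → subst (_≤ℤ M) (ℤₚ.+-comm 1ℤ (K ⋆ ∥ ε i ∥)) (ℤₚ.i<j⇒suc[i]≤j (close i))) ⟩
      K ⋆ M                            ∎)
      where open ℤₚ.≤-Reasoning

    term : ∀ i → s ⋆ ∥ y i ∥ ≤ℤ ∥ ε i ∥ + M ⋆ ∥ p i ∥
    term i = begin
      s ⋆ ∥ y i ∥             ≡⟨ cong (_⋆ ∥ y i ∥) (sym (ℤₚ.0≤i⇒+∣i∣≡i (ℤₚ.≤-trans (+≤+ z≤n) 1≤s))) ⟩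
      ∥ s ∥ ⋆ ∥ y i ∥         ≡⟨ sym (∥i*j∥ s (y i)) ⟩
      ∥ s ⋆ y i ∥             ≡⟨ cong ∥_∥ (split (s ⋆ y i) (M ⋆ p i)) ⟩
      ∥ ε i + M ⋆ p i ∥       ≤⟨ ∥i+j∥≤ (ε i) (M ⋆ p i) ⟩
      ∥ ε i ∥ + ∥ M ⋆ p i ∥   ≡⟨ cong (_+_ ∥ ε i ∥) (trans (∥i*j∥ M (p i)) (cong (_⋆ ∥ p i ∥) (ℤₚ.0≤i⇒+∣i∣≡i 0≤M))) ⟩
      ∥ ε i ∥ + M ⋆ ∥ p i ∥   ∎
      where
      open ℤₚ.≤-Reasoning
      split : ∀ a b → a ≡ a - b + b
      split = solve-∀

    sM≤ : s ⋆ M ≤ℤ E + M ⋆ P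
    sM≤ = begin
      s ⋆ M                               ≡⟨ cong (s ⋆_) M≡ ⟩
      s ⋆ ∑ xs (λ i → ∥ y i ∥)            ≡⟨ sym (∑-*ˡ xs s _) ⟩
      ∑ xs (λ i → s ⋆ ∥ y i ∥)            ≤⟨ ∑-mono xs term ⟩
      ∑ xs (λ i → ∥ ε i ∥ + M ⋆ ∥ p i ∥)  ≡⟨ trans (∑-+ xs _ _) (cong (_+_ E) (∑-*ˡ xs M _)) ⟩
      E + M ⋆ P                           ∎
      where open ℤₚ.≤-Reasoning

    impossible : 0ℤ ≤ℤ - 1ℤ
    impossible = subst (0ℤ ≤ℤ_) (identity s M E P)
      (ℤₚ.+-mono-≤ (ℤₚ.+-mono-≤ (ℤₚ.+-mono-≤
        (ℤₚ.i≤j⇒0≤j-i sM≤) (ℤₚ.i≤j⇒0≤j-i E<M))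
        (*-nonNeg 0≤M (ℤₚ.i≤j⇒0≤j-i (ℤₚ.≮⇒≥ 0≮P))))
        (*-nonNeg 0≤M (ℤₚ.i≤j⇒0≤j-i 1≤s)))
      where
      identity : ∀ s M E P → (E + M ⋆ P - s ⋆ M) + (M - (E + 1ℤ)) + M ⋆ (0ℤ - P) + M ⋆ (s - 1ℤ) ≡ - 1ℤ
      identity = solve-∀

  -- Since p is integral, it suffices that ∑ pᵢΔᵢ > -1, and this is inherited
  -- from the lower bound on ∑ yᵢΔᵢ.
  rounding-nonneg : 0ℤ <ℤ K → 0ℤ ≤ℤ s → 0ℤ ≤ℤ M → {D G : ℤ} → 0ℤ ≤ℤ D → (Δ : A → ℤ) →
                    (∀ i → ∥ Δ i ∥ ≤ℤ D) →
                    (∀ i → + 4 ⋆ K ⋆ D ⋆ ∥ ε i ∥ ≤ℤ M) →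
                    - G ≤ℤ + 2 ⋆ ∑[ i ← xs ] (y i ⋆ Δ i) →
                    s ⋆ G <ℤ M →
                    0ℤ ≤ℤ ∑[ i ← xs ] (p i ⋆ Δ i)
  rounding-nonneg 0<K 0≤s 0≤M {D} {G} 0≤D Δ Δ≤D close yΔ sG<M
    with 0ℤ ℤₚ.≤? ∑ xs (λ i → p i ⋆ Δ i)
  ... | yes 0≤P = 0≤P
  ... | no  0≰P = contradiction impossible λ ()
    where
    P Y E Z : ℤ
    P = ∑[ i ← xs ] (p i ⋆ Δ i)
    Y = ∑[ i ← xs ] (y i ⋆ Δ i)
    E = ∑[ i ← xs ] (ε i ⋆ Δ i)
    Z = + 4 ⋆ M ⋆ P + + 2 ⋆ s ⋆ G + M

    0≤K : 0ℤ ≤ℤ K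
    0≤K = ℤₚ.<⇒≤ 0<K

    E≡ : E ≡ s ⋆ Y - M ⋆ P
    E≡ = begin
      E                                                    ≡⟨ ∑-cong xs (λ i → expand s M (y i) (p i) (Δ i)) ⟩
      ∑ xs (λ i → s ⋆ (y i ⋆ Δ i) - M ⋆ (p i ⋆ Δ i))       ≡⟨ ∑-minus xs _ _ ⟩
      ∑ xs (λ i → s ⋆ (y i ⋆ Δ i)) - ∑ xs (λ i → M ⋆ (p i ⋆ Δ i))
                                                           ≡⟨ cong₂ _-_ (∑-*ˡ xs s _) (∑-*ˡ xs M _) ⟩
      s ⋆ Y - M ⋆ P                                        ∎
      where
      open ≡-Reasoning
      expand : ∀ s M y p d → (s ⋆ y - M ⋆ p) ⋆ d ≡ s ⋆ (y ⋆ d) - M ⋆ (p ⋆ d)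
      expand = solve-∀

    -- The accuracy 4 K D leaves each of the K terms at most M / 4K, so `E` takes up at most a
    -- quarter of M.
    E≤ : + 4 ⋆ K ⋆ E ≤ℤ K ⋆ M
    E≤ = begin
      + 4 ⋆ K ⋆ E                          ≡⟨ sym (∑-*ˡ xs (+ 4 ⋆ K) _) ⟩
      ∑ xs (λ i → + 4 ⋆ K ⋆ (ε i ⋆ Δ i))   ≤⟨ ∑-≤-const xs M term ⟩
      K ⋆ M                                ∎
      where
      open ℤₚ.≤-Reasoning
      0≤4K : 0ℤ ≤ℤ + 4 ⋆ K
      0≤4K = *-nonNeg {+ 4} (+≤+ z≤n) 0≤K
      rearrange : ∀ K e D → + 4 ⋆ K ⋆ (e ⋆ D) ≡ + 4 ⋆ K ⋆ D ⋆ e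
      rearrange = solve-∀
      term : ∀ i → + 4 ⋆ K ⋆ (ε i ⋆ Δ i) ≤ℤ M
      term i = begin
        + 4 ⋆ K ⋆ (ε i ⋆ Δ i)          ≤⟨ *-monoˡ 0≤4K (i≤∥i∥ (ε i ⋆ Δ i)) ⟩
        + 4 ⋆ K ⋆ ∥ ε i ⋆ Δ i ∥        ≡⟨ cong (+ 4 ⋆ K ⋆_) (∥i*j∥ (ε i) (Δ i)) ⟩
        + 4 ⋆ K ⋆ (∥ ε i ∥ ⋆ ∥ Δ i ∥)  ≤⟨ *-monoˡ 0≤4K (*-monoˡ (0≤∥∥ (ε i)) (Δ≤D i)) ⟩
        + 4 ⋆ K ⋆ (∥ ε i ∥ ⋆ D)        ≡⟨ rearrange K ∥ ε i ∥ D ⟩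
        + 4 ⋆ K ⋆ D ⋆ ∥ ε i ∥          ≤⟨ close i ⟩
        M                              ∎

    -- M P = s Y - E, where 2 s Y ≥ - s G and 4 E ≤ M; `Z` is 4 M P plus these two losses.
    0≤Z : 0ℤ ≤ℤ Z
    0≤Z = ℤₚ.*-cancelˡ-≤-pos 0ℤ Z K {{ℤ.positive 0<K}}
      (≤-by (+ 2 ⋆ K ⋆ s ⋆ (+ 2 ⋆ Y - - G) + (K ⋆ M - + 4 ⋆ K ⋆ E))
        (ℤₚ.+-mono-≤ (*-nonNeg (*-nonNeg (*-nonNeg {+ 2} (+≤+ z≤n) 0≤K) 0≤s) (ℤₚ.i≤j⇒0≤j-i yΔ))
                     (ℤₚ.i≤j⇒0≤j-i E≤))
        (trans (identity K s M G Y P) (cong (λ e → + 2 ⋆ K ⋆ s ⋆ (+ 2 ⋆ Y - - G) + (K ⋆ M - + 4 ⋆ K ⋆ e)) (sym E≡))))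
      where
      identity : ∀ K s M G Y P → K ⋆ (+ 4 ⋆ M ⋆ P + + 2 ⋆ s ⋆ G + M) - K ⋆ 0ℤ ≡
                 + 2 ⋆ K ⋆ s ⋆ (+ 2 ⋆ Y - - G) + (K ⋆ M - + 4 ⋆ K ⋆ (s ⋆ Y - M ⋆ P))
      identity = solve-∀

    -- From P ≤ -1 and s G ≤ M - 1 it follows that Z ≤ - M - 2, whereas Z and M are nonnegative.
    impossible : 0ℤ ≤ℤ - (+ 2)
    impossible = subst (0ℤ ≤ℤ_) (identity M P s G)
      (ℤₚ.+-mono-≤ (ℤₚ.+-mono-≤ (ℤₚ.+-mono-≤ 0≤Z
        (*-nonNeg (*-nonNeg {+ 4} (+≤+ z≤n) 0≤M) (ℤₚ.i≤j⇒0≤j-i (ℤₚ.i<j⇒suc[i]≤j (ℤₚ.≰⇒> 0≰P)))))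
        (*-nonNeg {+ 2} (+≤+ z≤n) (ℤₚ.i≤j⇒0≤j-i (ℤₚ.i<j⇒suc[i]≤j sG<M))))
        0≤M)
      where
      identity : ∀ M P s G →
        (+ 4 ⋆ M ⋆ P + + 2 ⋆ s ⋆ G + M) + + 4 ⋆ M ⋆ (0ℤ - (1ℤ + P)) + + 2 ⋆ (M - (1ℤ + s ⋆ G)) + M ≡ - (+ 2)
      identity = solve-∀

-- Here gs are the moves, Δ i g is the change of yᵢ under g, up to the factor K, and
-- ν g > 0 for the degenerate g that do not give a rearrangement at all.
module _ {A B : Set} (xs : List A) (gs : List B) (y p : A → ℤ) (Δ : A → B → ℤ) (ν : B → ℤ)
         {M s K D r e w a c : ℤ}
         (average-Δ : ∀ i → a ⋆ K ⋆ ∑[ g ← gs ] Δ i g ≡ - (w ⋆ r ⋆ (r ⋆ y i + e)))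
         (average-ν : a ⋆ ∑[ g ← gs ] ν g ≡ c ⋆ r ⋆ w)
         (0<w : 0ℤ <ℤ w) (1≤r : 1ℤ ≤ℤ r) (0≤s : 0ℤ ≤ℤ s) (0≤M : 0ℤ ≤ℤ M)
         (0≤a : 0ℤ ≤ℤ a) (0≤K : 0ℤ ≤ℤ K) (0≤D : 0ℤ ≤ℤ D)
         (0≤e : 0ℤ ≤ℤ e) (e≤ : e ≤ℤ r ⋆ r) (c≤ : c ≤ℤ r ⋆ r)
         (0<P₁ : 0ℤ <ℤ ∑[ i ← xs ] ∥ p i ∥)
         (pairing : ∀ i → M ⋆ ∥ p i ∥ ≤ℤ + 2 ⋆ s ⋆ (p i ⋆ y i))
         (almost-nonneg : ∀ g → 0ℤ ≤ℤ ∑[ i ← xs ] (p i ⋆ Δ i g) + ν g ⋆ (D ⋆ ∑[ i ← xs ] ∥ p i ∥))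
         where

  private
    P₁ P PY : ℤ
    P₁ = ∑[ i ← xs ] ∥ p i ∥
    P  = ∑ xs p
    PY = ∑[ i ← xs ] (p i ⋆ y i)

    0≤r : 0ℤ ≤ℤ r
    0≤r = ℤₚ.≤-trans (+≤+ z≤n) 1≤r

    0<r : 0ℤ <ℤ r
    0<r = ℤₚ.<-≤-trans (+<+ (s≤s z≤n)) 1≤r

    -- Exchanging the sums brings in the averages of Δ and ν. Both carry the factor w r, which
    -- `0≤total` divides out; this is where the number of vertices disappears.
    total : a ⋆ K ⋆ ∑[ g ← gs ] (∑[ i ← xs ] (p i ⋆ Δ i g) + ν g ⋆ (D ⋆ P₁)) ≡
            w ⋆ (r ⋆ (K ⋆ D ⋆ c ⋆ P₁ - (r ⋆ PY + e ⋆ P)))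
    total = begin
      a ⋆ K ⋆ ∑ gs (λ g → ∑ xs (λ i → p i ⋆ Δ i g) + ν g ⋆ (D ⋆ P₁))
        ≡⟨ cong (a ⋆ K ⋆_) (trans (∑-+ gs _ _) (cong₂ _+_ exchange (∑-*ʳ gs (D ⋆ P₁) ν))) ⟩
      a ⋆ K ⋆ (∑ xs (λ i → p i ⋆ ∑ gs (Δ i)) + ∑ gs ν ⋆ (D ⋆ P₁))
        ≡⟨ regroup a K (∑ xs (λ i → p i ⋆ ∑ gs (Δ i))) (∑ gs ν) (D ⋆ P₁) ⟩
      a ⋆ K ⋆ ∑ xs (λ i → p i ⋆ ∑ gs (Δ i)) + a ⋆ ∑ gs ν ⋆ (K ⋆ (D ⋆ P₁))
        ≡⟨ cong₂ _+_ averaged (cong (_⋆ (K ⋆ (D ⋆ P₁))) average-ν) ⟩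
      - (w ⋆ r) ⋆ (r ⋆ PY + e ⋆ P) + c ⋆ r ⋆ w ⋆ (K ⋆ (D ⋆ P₁))
        ≡⟨ collect w r (r ⋆ PY + e ⋆ P) c K D P₁ ⟩
      w ⋆ (r ⋆ (K ⋆ D ⋆ c ⋆ P₁ - (r ⋆ PY + e ⋆ P))) ∎
      where
      open ≡-Reasoning
      exchange : ∑ gs (λ g → ∑ xs (λ i → p i ⋆ Δ i g)) ≡ ∑ xs (λ i → p i ⋆ ∑ gs (Δ i))
      exchange = trans (∑-comm gs xs _) (∑-cong xs (λ i → ∑-*ˡ gs (p i) (Δ i)))
      regroup : ∀ a K S N d → a ⋆ K ⋆ (S + N ⋆ d) ≡ a ⋆ K ⋆ S + a ⋆ N ⋆ (K ⋆ d)
      regroup = solve-∀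
      pull : ∀ a p S → a ⋆ (p ⋆ S) ≡ p ⋆ (a ⋆ S)
      pull = solve-∀
      push : ∀ p v r y e → p ⋆ (- (v ⋆ (r ⋆ y + e))) ≡ - v ⋆ (r ⋆ (p ⋆ y) + e ⋆ p)
      push = solve-∀
      averaged : a ⋆ K ⋆ ∑ xs (λ i → p i ⋆ ∑ gs (Δ i)) ≡ - (w ⋆ r) ⋆ (r ⋆ PY + e ⋆ P)
      averaged = begin
        a ⋆ K ⋆ ∑ xs (λ i → p i ⋆ ∑ gs (Δ i))
          ≡⟨ sym (∑-*ˡ xs (a ⋆ K) _) ⟩
        ∑ xs (λ i → a ⋆ K ⋆ (p i ⋆ ∑ gs (Δ i)))
          ≡⟨ ∑-cong xs (λ i → trans (pull (a ⋆ K) (p i) (∑ gs (Δ i)))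
               (trans (cong (p i ⋆_) (average-Δ i)) (push (p i) (w ⋆ r) r (y i) e))) ⟩
        ∑ xs (λ i → - (w ⋆ r) ⋆ (r ⋆ (p i ⋆ y i) + e ⋆ p i))
          ≡⟨ trans (∑-*ˡ xs (- (w ⋆ r)) _) (cong (- (w ⋆ r) ⋆_)
               (trans (∑-+ xs _ _) (cong₂ _+_ (∑-*ˡ xs r _) (∑-*ˡ xs e p)))) ⟩
        - (w ⋆ r) ⋆ (r ⋆ PY + e ⋆ P) ∎
      collect : ∀ w r X c K D P → - (w ⋆ r) ⋆ X + c ⋆ r ⋆ w ⋆ (K ⋆ (D ⋆ P)) ≡
                                  w ⋆ (r ⋆ (K ⋆ D ⋆ c ⋆ P - X))
      collect = solve-∀

    0≤total : 0ℤ ≤ℤ K ⋆ D ⋆ c ⋆ P₁ - (r ⋆ PY + e ⋆ P)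
    0≤total = cancel 0<r (cancel 0<w (subst (0ℤ ≤ℤ_) total
      (*-nonNeg (*-nonNeg 0≤a 0≤K) (∑-nonNeg gs almost-nonneg))))
      where
      cancel : ∀ {l z} → 0ℤ <ℤ l → 0ℤ ≤ℤ l ⋆ z → 0ℤ ≤ℤ z
      cancel {l} {z} 0<l 0≤lz = ℤₚ.*-cancelˡ-≤-pos 0ℤ z l {{ℤ.positive 0<l}}
        (subst (_≤ℤ l ⋆ z) (sym (ℤₚ.*-zeroʳ l)) 0≤lz)

    0≤P₁ : 0ℤ ≤ℤ P₁
    0≤P₁ = ℤₚ.<⇒≤ 0<P₁

    0≤P₁+P : 0ℤ ≤ℤ P₁ + P
    0≤P₁+P = subst (0ℤ ≤ℤ_) (∑-+ xs _ p) (∑-nonNeg xs (λ i → 0≤∥i∥+i (p i)))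

    MP₁≤ : M ⋆ P₁ ≤ℤ + 2 ⋆ s ⋆ PY
    MP₁≤ = subst₂ _≤ℤ_ (∑-*ˡ xs M _) (∑-*ˡ xs (+ 2 ⋆ s) _) (∑-mono xs pairing)

  -- The averaged inequality reads r PY ≤ K D c P₁ - e P, and the pairing gives M P₁ ≤ 2 s PY. As c
  -- and e are at most r² and - P ≤ P₁, everything on the right is a multiple of P₁, which is
  -- positive and cancels.
  averaging-bound : M ≤ℤ + 2 ⋆ s ⋆ (r ⋆ r ⋆ (K ⋆ D + 1ℤ))
  averaging-bound = ℤₚ.*-cancelʳ-≤-pos M _ P₁ {{ℤ.positive 0<P₁}}
    (≤-by ((r - 1ℤ) ⋆ (M ⋆ P₁) + r ⋆ (+ 2 ⋆ s ⋆ PY - M ⋆ P₁)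
           + + 2 ⋆ s ⋆ ((K ⋆ D ⋆ c ⋆ P₁ - (r ⋆ PY + e ⋆ P))
                        + K ⋆ D ⋆ (r ⋆ r - c) ⋆ P₁ + (r ⋆ r - e) ⋆ P₁ + e ⋆ (P₁ + P)))
      (ℤₚ.+-mono-≤ (ℤₚ.+-mono-≤
        (*-nonNeg (ℤₚ.i≤j⇒0≤j-i 1≤r) (*-nonNeg 0≤M 0≤P₁))
        (*-nonNeg 0≤r (ℤₚ.i≤j⇒0≤j-i MP₁≤)))
        (*-nonNeg (*-nonNeg {+ 2} (+≤+ z≤n) 0≤s)
          (ℤₚ.+-mono-≤ (ℤₚ.+-mono-≤ (ℤₚ.+-mono-≤ 0≤total
            (*-nonNeg (*-nonNeg (*-nonNeg 0≤K 0≤D) (ℤₚ.i≤j⇒0≤j-i c≤)) 0≤P₁))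
            (*-nonNeg (ℤₚ.i≤j⇒0≤j-i e≤) 0≤P₁))
            (*-nonNeg 0≤e 0≤P₁+P))))
      (identity M s r K D c e P₁ P PY))
    where
    identity : ∀ M s r K D c e P₁ P PY →
      + 2 ⋆ s ⋆ (r ⋆ r ⋆ (K ⋆ D + 1ℤ)) ⋆ P₁ - M ⋆ P₁ ≡
      (r - 1ℤ) ⋆ (M ⋆ P₁) + r ⋆ (+ 2 ⋆ s ⋆ PY - M ⋆ P₁)
      + + 2 ⋆ s ⋆ ((K ⋆ D ⋆ c ⋆ P₁ - (r ⋆ PY + e ⋆ P))
                   + K ⋆ D ⋆ (r ⋆ r - c) ⋆ P₁ + (r ⋆ r - e) ⋆ P₁ + e ⋆ (P₁ + P))
    identity = solve-∀

length-allFin : ∀ n → + length (allFin n) ≡ + n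
length-allFin n = cong +_ (Listₚ.length-tabulate id)

≤-∑ : ∀ {n} (a : Fin n) {f : Fin n → ℤ} → (∀ x → 0ℤ ≤ℤ f x) → f a ≤ℤ ∑ (allFin n) f
≤-∑ {n} a {f} 0≤f = subst (_≤ℤ ∑ (allFin n) f) (allFin-enumerates n a f)
  (∑-mono (allFin n) (λ x → subst (⟦ x Finₚ.≟ a ⟧ ⋆ f x ≤ℤ_) (ℤₚ.*-identityˡ (f x))
                                  (*-monoʳ (0≤f x) (⟦⟧≤1 (x Finₚ.≟ a)))))

-- A move alters only the copies in the image of `copyOf`; this reduces its effect on a sum over all
-- copies to r terms.
∑-image : ∀ {r m} (j : Fin r → Fin m) → Injective _≡_ _≡_ j → (f : Fin m → ℤ) →
          (∀ x → ¬ (∃[ t ] j t ≡ x) → f x ≡ 0ℤ) → ∑ (allFin m) f ≡ ∑ (allFin r) (f ∘ j)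
∑-image {r} {m} j j-inj f off-image = sym (begin
  ∑ (allFin r) (f ∘ j)
    ≡⟨ ∑-cong (allFin r) (λ t → sym (allFin-enumerates m (j t) f)) ⟩
  ∑[ t ← allFin r ] ∑[ x ← allFin m ] (⟦ x Finₚ.≟ j t ⟧ ⋆ f x)
    ≡⟨ ∑-comm (allFin r) (allFin m) _ ⟩
  ∑[ x ← allFin m ] ∑[ t ← allFin r ] (⟦ x Finₚ.≟ j t ⟧ ⋆ f x)
    ≡⟨ ∑-cong (allFin m) fibre ⟩
  ∑ (allFin m) f ∎)
  where
  open ≡-Reasoning
  fibre : ∀ x → ∑[ t ← allFin r ] (⟦ x Finₚ.≟ j t ⟧ ⋆ f x) ≡ f x
  fibre x with Finₚ.any? (λ t → j t Finₚ.≟ x)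
  ... | yes (t₀ , refl) = trans
    (∑-cong (allFin r) (λ t → cong (_⋆ f (j t₀))
      (⟦⟧-cong (j t₀ Finₚ.≟ j t) (t Finₚ.≟ t₀) (sym ∘ j-inj) (cong j ∘ sym))))
    (allFin-enumerates r t₀ (λ _ → f (j t₀)))
  ... | no ∄t = trans
    (∑-zero (allFin r) (λ t → trans (cong (⟦ x Finₚ.≟ j t ⟧ ⋆_) (off-image x ∄t)) (ℤₚ.*-zeroʳ ⟦ x Finₚ.≟ j t ⟧)))
    (sym (off-image x ∄t))

-- Rearranging r copies

module _ {r : ℕ} .{{_ : NonZero r}} where

  infixl 6 _⊕_ _⊖_

  -- The table of ℤ / r serves as a Latin square: new copy t takes its vertex a from old copy number
  -- t ⊕ a, so every new copy meets every chosen old copy exactly once.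
  _⊕_ _⊖_ : Fin r → Fin r → Fin r
  a ⊕ b = fromℕ< (m%n<n (toℕ a ℕ.+ toℕ b) r)
  a ⊖ b = fromℕ< (m%n<n (toℕ a ℕ.+ (r ℕ.∸ toℕ b)) r)

  ⊕-comm : ∀ a b → a ⊕ b ≡ b ⊕ a
  ⊕-comm a b = Finₚ.fromℕ<-cong _ _ (cong (_% r) (ℕₚ.+-comm (toℕ a) (toℕ b))) _ _

  private
    %-absorb : ∀ x y → (x % r ℕ.+ y) % r ≡ (x ℕ.+ y) % r
    %-absorb x y = begin
      (x % r ℕ.+ y) % r          ≡⟨ %-distribˡ-+ (x % r) y r ⟩
      (x % r % r ℕ.+ y % r) % r  ≡⟨ cong (λ z → (z ℕ.+ y % r) % r) (m%n%n≡m%n x r) ⟩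
      (x % r ℕ.+ y % r) % r      ≡⟨ sym (%-distribˡ-+ x y r) ⟩
      (x ℕ.+ y) % r              ∎
      where open ≡-Reasoning

    -- x and y stand for toℕ b and r ∸ toℕ b, in either order.
    cancel : ∀ (a : Fin r) x y → x ℕ.+ y ≡ r →
             (z : Fin r) → toℕ z ≡ (toℕ a ℕ.+ x) % r → (toℕ z ℕ.+ y) % r ≡ toℕ a
    cancel a x y x+y≡r z z≡ = begin
      (toℕ z ℕ.+ y) % r              ≡⟨ cong (λ w → (w ℕ.+ y) % r) z≡ ⟩
      ((toℕ a ℕ.+ x) % r ℕ.+ y) % r  ≡⟨ %-absorb (toℕ a ℕ.+ x) y ⟩
      (toℕ a ℕ.+ x ℕ.+ y) % r        ≡⟨ cong (_% r) (trans (ℕₚ.+-assoc (toℕ a) x y) (cong (toℕ a ℕ.+_) x+y≡r)) ⟩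
      (toℕ a ℕ.+ r) % r              ≡⟨ [m+n]%n≡m%n (toℕ a) r ⟩
      toℕ a % r                      ≡⟨ m<n⇒m%n≡m (Finₚ.toℕ<n a) ⟩
      toℕ a                          ∎
      where open ≡-Reasoning

  ⊕-⊖ : ∀ a b → a ⊕ b ⊖ b ≡ a
  ⊕-⊖ a b = Finₚ.toℕ-injective (trans (Finₚ.toℕ-fromℕ< _)
    (cancel a (toℕ b) (r ℕ.∸ toℕ b) (ℕₚ.m+[n∸m]≡n (ℕₚ.<⇒≤ (Finₚ.toℕ<n b))) (a ⊕ b) (Finₚ.toℕ-fromℕ< _)))

  ⊖-⊕ : ∀ a b → a ⊖ b ⊕ b ≡ a
  ⊖-⊕ a b = Finₚ.toℕ-injective (trans (Finₚ.toℕ-fromℕ< _)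
    (cancel a (r ℕ.∸ toℕ b) (toℕ b) (ℕₚ.m∸n+n≡m (ℕₚ.<⇒≤ (Finₚ.toℕ<n b))) (a ⊖ b) (Finₚ.toℕ-fromℕ< _)))

  ⊕-injectiveʳ : ∀ t {a b} → t ⊕ a ≡ t ⊕ b → a ≡ b
  ⊕-injectiveʳ t {a} {b} eq = trans (sym (⊕-⊖ a t))
    (trans (cong (_⊖ t) (trans (⊕-comm a t) (trans eq (⊕-comm t b)))) (⊕-⊖ b t))

-- A pair (j , a) is the place of vertex a of H in the j-th copy.
Position : ℕ → ℕ → Set
Position m r = Fin m × Fin r

_≟ₚ_ : ∀ {m r} → DecidableEquality (Position m r)
_≟ₚ_ = Productₚ.≡-dec Finₚ._≟_ Finₚ._≟_

positions : ∀ m r → List (Position m r)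
positions m r = cartesianProduct (allFin m) (allFin r)

∑-positions : ∀ m r (f : Position m r → ℤ) →
              ∑ (positions m r) f ≡ ∑[ j ← allFin m ] ∑[ a ← allFin r ] f (j , a)
∑-positions m r f = ∑-cartesian _,_ (allFin m) (allFin r) f

length-positions : ∀ m r → + length (positions m r) ≡ + m ⋆ + r
length-positions m r = begin
  + length (positions m r)                      ≡⟨ sym (trans (∑-const (positions m r) 1ℤ) (ℤₚ.*-identityʳ _)) ⟩
  ∑ (positions m r) (λ _ → 1ℤ)                  ≡⟨ ∑-positions m r _ ⟩
  ∑ (allFin m) (λ _ → ∑ (allFin r) (λ _ → 1ℤ))  ≡⟨ ∑-const (allFin m) _ ⟩
  + length (allFin m) ⋆ ∑ (allFin r) (λ _ → 1ℤ) ≡⟨ cong₂ _⋆_ (length-allFin m) (trans (∑-const (allFin r) 1ℤ) (trans (ℤₚ.*-identityʳ _) (length-allFin r))) ⟩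
  + m ⋆ + r                                     ∎
  where open ≡-Reasoning

positions-enumerates : ∀ m r → Enumerates _≟ₚ_ (positions m r)
positions-enumerates m r (j , a) f = begin
  ∑ (positions m r) (λ x → ⟦ x ≟ₚ (j , a) ⟧ ⋆ f x)
    ≡⟨ ∑-positions m r _ ⟩
  ∑[ j′ ← allFin m ] ∑[ a′ ← allFin r ] (⟦ (j′ , a′) ≟ₚ (j , a) ⟧ ⋆ f (j′ , a′))
    ≡⟨ ∑-cong (allFin m) (λ j′ → trans (∑-cong (allFin r) (λ a′ → split j′ a′))
         (∑-*ˡ (allFin r) ⟦ j′ Finₚ.≟ j ⟧ _)) ⟩
  ∑[ j′ ← allFin m ] (⟦ j′ Finₚ.≟ j ⟧ ⋆ ∑[ a′ ← allFin r ] (⟦ a′ Finₚ.≟ a ⟧ ⋆ f (j′ , a′)))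
    ≡⟨ allFin-enumerates m j _ ⟩
  ∑[ a′ ← allFin r ] (⟦ a′ Finₚ.≟ a ⟧ ⋆ f (j , a′))
    ≡⟨ allFin-enumerates r a _ ⟩
  f (j , a) ∎
  where
  open ≡-Reasoning
  split : ∀ j′ a′ → ⟦ (j′ , a′) ≟ₚ (j , a) ⟧ ⋆ f (j′ , a′) ≡
                    ⟦ j′ Finₚ.≟ j ⟧ ⋆ (⟦ a′ Finₚ.≟ a ⟧ ⋆ f (j′ , a′))
  split j′ a′ = trans (cong (_⋆ f (j′ , a′))
    (trans (⟦⟧-cong ((j′ , a′) ≟ₚ (j , a)) (j′ Finₚ.≟ j ×-dec a′ Finₚ.≟ a)
             (λ eq → Productₚ.,-injectiveˡ eq , Productₚ.,-injectiveʳ eq) (λ { (refl , refl) → refl }))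
           (⟦⟧-× (j′ Finₚ.≟ j) (a′ Finₚ.≟ a))))
    (ℤₚ.*-assoc ⟦ j′ Finₚ.≟ j ⟧ ⟦ a′ Finₚ.≟ a ⟧ (f (j′ , a′)))

module _ {m r : ℕ} .{{_ : NonZero r}} (g : Vec (Position m r) r) where

  -- Each coordinate of `g` names an old copy together with a cyclic offset for its vertices. The
  -- offset spreads the vertex taken from that copy uniformly over all r of its places.
  copyOf : Fin r → Fin m
  copyOf t = proj₁ (lookup g t)

  -- The new copies are transversal to the old ones, so that their edges join
  -- different old copies.
  moved : Fin r → Fin r → Position m r
  moved t a = copyOf (t ⊕ a) , a ⊕ proj₂ (lookup g (t ⊕ a))

  private
    -- The place b in old copy u determines a, by undoing the offset of u, and then the new copy t =
    -- u ⊖ a.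
    moved⁻¹ : Fin r → Fin r → Position m r
    moved⁻¹ u b = copyOf (u ⊖ (b ⊖ proj₂ (lookup g u))) , b ⊖ proj₂ (lookup g u)

    -- Defined for every `g`: if a copy is repeated, the search settles on some index for it. Under
    -- injectivity the index is the only one.
    onImage : (Fin r → Fin r → Position m r) → Position m r → Position m r
    onImage f (j , a) with Finₚ.any? (λ t → copyOf t Finₚ.≟ j)
    ... | yes (t , _) = f t a
    ... | no _        = j , a

    onImage-no : ∀ f {j} a → ¬ (∃[ t ] copyOf t ≡ j) → onImage f (j , a) ≡ (j , a)
    onImage-no f {j} a ∄t with Finₚ.any? (λ t → copyOf t Finₚ.≟ j)
    ... | yes ∃t = contradiction ∃t ∄t
    ... | no _   = refl

  move move⁻¹ : Position m r → Position m r
  move   = onImage moved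
  move⁻¹ = onImage moved⁻¹

  move-fixed : ∀ {j} a → ¬ (∃[ t ] copyOf t ≡ j) → move (j , a) ≡ (j , a)
  move-fixed = onImage-no moved

  module _ (inj : Injective _≡_ _≡_ copyOf) where

    private
      onImage-yes : ∀ f t a → onImage f (copyOf t , a) ≡ f t a
      onImage-yes f t a with Finₚ.any? (λ u → copyOf u Finₚ.≟ copyOf t)
      ... | yes (u , eq) = cong (λ v → f v a) (inj eq)
      ... | no ∄u        = contradiction (t , refl) ∄u

    move-moved : ∀ t a → move (copyOf t , a) ≡ moved t a
    move-moved = onImage-yes moved

    private
      moved-moved⁻¹ : ∀ u b → move (moved⁻¹ u b) ≡ (copyOf u , b)
      moved-moved⁻¹ u b = begin
        move (copyOf (u ⊖ a) , a)                          ≡⟨ move-moved (u ⊖ a) a ⟩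
        copyOf (u ⊖ a ⊕ a) , a ⊕ proj₂ (lookup g (u ⊖ a ⊕ a)) ≡⟨ cong (λ v → copyOf v , a ⊕ proj₂ (lookup g v)) (⊖-⊕ u a) ⟩
        copyOf u , a ⊕ proj₂ (lookup g u)                  ≡⟨ cong (copyOf u ,_) (⊖-⊕ b (proj₂ (lookup g u))) ⟩
        copyOf u , b                                       ∎
        where
        open ≡-Reasoning
        a = b ⊖ proj₂ (lookup g u)

      moved⁻¹-moved : ∀ t a → move⁻¹ (moved t a) ≡ (copyOf t , a)
      moved⁻¹-moved t a = begin
        move⁻¹ (copyOf u , a ⊕ s)               ≡⟨ onImage-yes moved⁻¹ u (a ⊕ s) ⟩
        copyOf (u ⊖ (a ⊕ s ⊖ s)) , a ⊕ s ⊖ s    ≡⟨ cong (λ b → copyOf (u ⊖ b) , b) (⊕-⊖ a s) ⟩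
        copyOf (t ⊕ a ⊖ a) , a                  ≡⟨ cong (λ v → copyOf v , a) (⊕-⊖ t a) ⟩
        copyOf t , a                            ∎
        where
        open ≡-Reasoning
        u = t ⊕ a
        s = proj₂ (lookup g u)

    move-move⁻¹ : ∀ x → move (move⁻¹ x) ≡ x
    move-move⁻¹ (j , b) with Finₚ.any? (λ t → copyOf t Finₚ.≟ j)
    ... | yes (u , refl) = moved-moved⁻¹ u b
    ... | no ∄u          = move-fixed b ∄u

    move⁻¹-move : ∀ x → move⁻¹ (move x) ≡ x
    move⁻¹-move (j , a) with Finₚ.any? (λ t → copyOf t Finₚ.≟ j)
    ... | yes (t , refl) = moved⁻¹-moved t a
    ... | no ∄t          = onImage-no moved⁻¹ a ∄t

-- The weight of a colour and its average change

module Weights {m r : ℕ} .{{_ : NonZero r}} (h : Fin r → Fin r → ℤ) where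

  copyWeight : (Position m r → Position m r → ℤ) → (Fin r → Position m r) → ℤ
  copyWeight χ f = ∑[ a ← allFin r ] ∑[ b ← allFin r ] (h a b ⋆ χ (f a) (f b))

  weight : (Position m r → Position m r → ℤ) → (Position m r → Position m r) → ℤ
  weight χ σ = ∑[ j ← allFin m ] copyWeight χ (λ a → σ (j , a))

  copyWeight-cong : ∀ χ {f f′ : Fin r → Position m r} → (∀ a → f a ≡ f′ a) →
                    copyWeight χ f ≡ copyWeight χ f′
  copyWeight-cong χ eq = ∑-cong (allFin r) (λ a → ∑-cong (allFin r) (λ b →
    cong₂ (λ x y → h a b ⋆ χ x y) (eq a) (eq b)))

  edgeWeight : ℤ
  edgeWeight = ∑[ a ← allFin r ] ∑[ b ← allFin r ] h a b

  -- A formula that makes sense for all tuples, so that averages run over all of them; it is the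
  -- change of weight when `copyOf g` is injective.
  Δ : (Position m r → Position m r → ℤ) → Vec (Position m r) r → ℤ
  Δ χ g = ∑[ t ← allFin r ] (copyWeight χ (moved g t) - copyWeight χ (λ a → copyOf g t , a))

  weight-move : ∀ χ g → Injective _≡_ _≡_ (copyOf g) → weight χ (move g) ≡ weight χ id + Δ χ g
  weight-move χ g inj = begin
    weight χ (move g)
      ≡⟨ split (weight χ (move g)) (weight χ id) ⟩
    weight χ id + (weight χ (move g) - weight χ id)
      ≡⟨ cong (_+_ (weight χ id)) (sym (∑-minus (allFin m) _ _)) ⟩
    weight χ id + ∑[ j ← allFin m ] change j
      ≡⟨ cong (_+_ (weight χ id)) (∑-image (copyOf g) inj change unchanged) ⟩
    weight χ id + ∑[ t ← allFin r ] change (copyOf g t)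
      ≡⟨ cong (_+_ (weight χ id)) (∑-cong (allFin r) (λ t →
           cong (_- copyWeight χ (λ a → copyOf g t , a)) (copyWeight-cong χ (move-moved g inj t)))) ⟩
    weight χ id + Δ χ g ∎
    where
    open ≡-Reasoning
    split : ∀ a b → a ≡ b + (a - b)
    split = solve-∀
    change : Fin m → ℤ
    change j = copyWeight χ (λ a → move g (j , a)) - copyWeight χ (λ a → j , a)
    unchanged : ∀ j → ¬ (∃[ t ] copyOf g t ≡ j) → change j ≡ 0ℤ
    unchanged j ∄t = trans
      (cong (_- copyWeight χ (λ a → j , a)) (copyWeight-cong χ (λ a → move-fixed g a ∄t)))
      (ℤₚ.i≡j⇒i-j≡0 {copyWeight χ (λ a → j , a)} refl)

  Unit : (Position m r → Position m r → ℤ) → Set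
  Unit χ = ∀ x y → 0ℤ ≤ℤ χ x y × χ x y ≤ℤ 1ℤ

  module _ (0≤h : ∀ a b → 0ℤ ≤ℤ h a b) (h≤1 : ∀ a b → h a b ≤ℤ 1ℤ) where

    edgeWeight-nonNeg : 0ℤ ≤ℤ edgeWeight
    edgeWeight-nonNeg = ∑-nonNeg (allFin r) (λ a → ∑-nonNeg (allFin r) (0≤h a))

    edgeWeight≤ : edgeWeight ≤ℤ + r ⋆ + r
    edgeWeight≤ = subst (edgeWeight ≤ℤ_)
      (cong₂ _⋆_ (length-allFin r) (trans (ℤₚ.*-identityʳ _) (length-allFin r)))
      (∑-≤-const (allFin r) _ (λ a → ∑-≤-const (allFin r) 1ℤ (h≤1 a)))

    -- There are r copies with r² ordered pairs each, and a pair contributes a difference of two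
    -- numbers between 0 and 1, hence at most 1 in absolute value.
    ∥Δ∥≤ : ∀ χ → Unit χ → ∀ g → ∥ Δ χ g ∥ ≤ℤ + r ⋆ (+ r ⋆ + r)
    ∥Δ∥≤ χ unit g = begin
      ∥ Δ χ g ∥
        ≡⟨ cong ∥_∥ (∑-cong (allFin r) (λ t → trans (sym (∑-minus (allFin r) _ _))
             (∑-cong (allFin r) (λ a → sym (∑-minus (allFin r) _ _))))) ⟩
      ∥ ∑[ t ← allFin r ] ∑[ a ← allFin r ] ∑[ b ← allFin r ] diff t a b ∥
        ≤⟨ bound (λ t → bound (λ a → bound (∥diff∥≤1 t a))) ⟩
      + r ⋆ (+ r ⋆ (+ r ⋆ 1ℤ))
        ≡⟨ cong (λ z → + r ⋆ (+ r ⋆ z)) (ℤₚ.*-identityʳ (+ r)) ⟩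
      + r ⋆ (+ r ⋆ + r) ∎
      where
      open ℤₚ.≤-Reasoning

      new old diff : Fin r → Fin r → Fin r → ℤ
      new t a b = h a b ⋆ χ (moved g t a) (moved g t b)
      old t a b = h a b ⋆ χ (copyOf g t , a) (copyOf g t , b)
      diff t a b = new t a b - old t a b

      bound : ∀ {f : Fin r → ℤ} {c} → (∀ x → ∥ f x ∥ ≤ℤ c) → ∥ ∑ (allFin r) f ∥ ≤ℤ + r ⋆ c
      bound {f} {c} ≤c = ℤₚ.≤-trans (∥∑∥≤ (allFin r) f)
        (subst (λ l → ∑[ x ← allFin r ] ∥ f x ∥ ≤ℤ l ⋆ c) (length-allFin r) (∑-≤-const (allFin r) c ≤c))

      0≤hχ : ∀ a b x y → 0ℤ ≤ℤ h a b ⋆ χ x y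
      0≤hχ a b x y = *-nonNeg (0≤h a b) (proj₁ (unit x y))

      hχ≤1 : ∀ a b x y → h a b ⋆ χ x y ≤ℤ 1ℤ
      hχ≤1 a b x y = *-mono-nonNeg {b = 1ℤ} {d = 1ℤ} (+≤+ z≤n) (proj₁ (unit x y)) (h≤1 a b) (proj₂ (unit x y))

      ∥u-v∥≤1 : ∀ {u v} → 0ℤ ≤ℤ u → u ≤ℤ 1ℤ → 0ℤ ≤ℤ v → v ≤ℤ 1ℤ → ∥ u - v ∥ ≤ℤ 1ℤ
      ∥u-v∥≤1 {u} {v} 0≤u u≤1 0≤v v≤1 = ∥i∥≤ {u - v}
        (≤-by (1ℤ - u + v) (ℤₚ.+-mono-≤ (ℤₚ.i≤j⇒0≤j-i u≤1) 0≤v) (identity₁ u v))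
        (≤-by (1ℤ - v + u) (ℤₚ.+-mono-≤ (ℤₚ.i≤j⇒0≤j-i v≤1) 0≤u) (identity₂ u v))
        where
        identity₁ : ∀ u v → 1ℤ - (u - v) ≡ 1ℤ - u + v
        identity₁ = solve-∀
        identity₂ : ∀ u v → 1ℤ - (- (u - v)) ≡ 1ℤ - v + u
        identity₂ = solve-∀

      ∥diff∥≤1 : ∀ t a b → ∥ diff t a b ∥ ≤ℤ 1ℤ
      ∥diff∥≤1 t a b = ∥u-v∥≤1 (0≤hχ a b _ _) (hχ≤1 a b _ _) (0≤hχ a b _ _) (hχ≤1 a b _ _)

  private
    ps : List (Position m r)
    ps = positions m r

    gs : List (Vec (Position m r) r)
    gs = tuples ps r

    q W R : ℤ
    q = + length ps
    W = + length gs
    R = + r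

  module _ (h-irrefl : ∀ a → h a a ≡ 0ℤ) (χ : Position m r → Position m r → ℤ) where

    private
      S : ℤ
      S = ∑[ x ← ps ] ∑[ y ← ps ] χ x y

      rotate : (Fin r → Fin r) → Position m r → Position m r
      rotate f (j , s) = j , f s

      ∑-rotate : ∀ a (f : Position m r → ℤ) → ∑ ps (f ∘ rotate (a ⊕_)) ≡ ∑ ps f
      ∑-rotate a f = ∑-reindex _≟ₚ_ _≟ₚ_ ps ps (positions-enumerates m r) (positions-enumerates m r)
        (rotate (a ⊕_)) (rotate (_⊖ a))
        (λ (j , s) → cong (j ,_) (trans (⊕-comm a (s ⊖ a)) (⊖-⊕ s a)))
        (λ (j , s) → cong (j ,_) (trans (cong (_⊖ a) (⊕-comm a s)) (⊕-⊖ s a)))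
        f

      -- For a ≠ b the two ends come from the different coordinates t ⊕ a and t ⊕ b, so they are
      -- independent; rotating the offsets by a and b keeps them uniform.
      average-moved-edge : ∀ t {a b} → a ≢ b →
        q ⋆ q ⋆ ∑[ g ← gs ] χ (moved g t a) (moved g t b) ≡ W ⋆ S
      average-moved-edge t {a} {b} a≢b = trans
        (∑-tuples-lookup₂ ps r (a≢b ∘ ⊕-injectiveʳ t) (λ x y → χ (rotate (a ⊕_) x) (rotate (b ⊕_) y)))
        (cong (W ⋆_) (trans (∑-cong ps (λ x → ∑-rotate b (χ (rotate (a ⊕_) x))))
                            (∑-rotate a (λ x → ∑ ps (χ x)))))

      average-new : ∀ t → q ⋆ q ⋆ ∑[ g ← gs ] copyWeight χ (moved g t) ≡ edgeWeight ⋆ (W ⋆ S)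
      average-new t = begin
        q ⋆ q ⋆ ∑[ g ← gs ] copyWeight χ (moved g t)
          ≡⟨ cong (q ⋆ q ⋆_) (trans (∑-comm gs (allFin r) _) (∑-cong (allFin r) (λ a → ∑-comm gs (allFin r) _))) ⟩
        q ⋆ q ⋆ ∑[ a ← allFin r ] ∑[ b ← allFin r ] ∑[ g ← gs ] (h a b ⋆ χ (moved g t a) (moved g t b))
          ≡⟨ trans (sym (∑-*ˡ (allFin r) (q ⋆ q) _)) (∑-cong (allFin r) (λ a → sym (∑-*ˡ (allFin r) (q ⋆ q) _))) ⟩
        ∑[ a ← allFin r ] ∑[ b ← allFin r ] (q ⋆ q ⋆ ∑[ g ← gs ] (h a b ⋆ χ (moved g t a) (moved g t b)))
          ≡⟨ ∑-cong (allFin r) (λ a → ∑-cong (allFin r) (edge a)) ⟩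
        ∑[ a ← allFin r ] ∑[ b ← allFin r ] (h a b ⋆ (W ⋆ S))
          ≡⟨ trans (∑-cong (allFin r) (λ a → ∑-*ʳ (allFin r) (W ⋆ S) (h a))) (∑-*ʳ (allFin r) (W ⋆ S) _) ⟩
        edgeWeight ⋆ (W ⋆ S) ∎
        where
        open ≡-Reasoning
        pull : ∀ a c s → a ⋆ (c ⋆ s) ≡ c ⋆ (a ⋆ s)
        pull = solve-∀
        edge : ∀ a b → q ⋆ q ⋆ ∑[ g ← gs ] (h a b ⋆ χ (moved g t a) (moved g t b)) ≡ h a b ⋆ (W ⋆ S)
        edge a b = trans (cong (q ⋆ q ⋆_) (∑-*ˡ gs (h a b) _)) (trans (pull (q ⋆ q) (h a b) _) (cases (a Finₚ.≟ b)))
          where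
          cases : Dec (a ≡ b) → h a b ⋆ (q ⋆ q ⋆ ∑[ g ← gs ] χ (moved g t a) (moved g t b)) ≡ h a b ⋆ (W ⋆ S)
          -- On the diagonal the ends coincide and are not independent, but `h` vanishes there.
          cases (yes refl) = trans (cong (_⋆ (q ⋆ q ⋆ ∑[ g ← gs ] χ (moved g t a) (moved g t a))) (h-irrefl a)) (sym (cong (_⋆ (W ⋆ S)) (h-irrefl a)))
          cases (no a≢b)   = cong (h a b ⋆_) (average-moved-edge t a≢b)

      -- The old copy depends on one coordinate only, and each copy is hit once for each of the r
      -- offsets; hence the factor `R`.
      average-old : ∀ t → q ⋆ ∑[ g ← gs ] copyWeight χ (λ a → copyOf g t , a) ≡ W ⋆ (R ⋆ weight χ id)
      average-old t = trans (∑-tuples-lookup ps r t (λ x → copyWeight χ (λ a → proj₁ x , a)))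
        (cong (W ⋆_) (trans (∑-positions m r _)
          (trans (∑-cong (allFin m) (λ j → trans (∑-const (allFin r) _) (cong (_⋆ copyWeight χ (λ a → j , a)) (length-allFin r))))
                 (∑-*ˡ (allFin m) R _))))

    -- Divided by q² W, this is r times the mean weight of a copy with random ends, `edgeWeight` S /
    -- q², minus r times the mean weight of an old copy, since q = m r.
    average-Δ : q ⋆ q ⋆ ∑[ g ← gs ] Δ χ g ≡ R ⋆ (edgeWeight ⋆ (W ⋆ S) - q ⋆ (W ⋆ (R ⋆ weight χ id)))
    average-Δ = begin
      q ⋆ q ⋆ ∑[ g ← gs ] Δ χ g
        ≡⟨ cong (q ⋆ q ⋆_) (∑-comm gs (allFin r) _) ⟩
      q ⋆ q ⋆ ∑[ t ← allFin r ] ∑[ g ← gs ] (new t g - old t g)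
        ≡⟨ sym (∑-*ˡ (allFin r) (q ⋆ q) _) ⟩
      ∑[ t ← allFin r ] (q ⋆ q ⋆ ∑[ g ← gs ] (new t g - old t g))
        ≡⟨ ∑-cong (allFin r) (λ t → trans (cong (q ⋆ q ⋆_) (∑-minus gs (new t) (old t)))
             (trans (distrib q (∑ gs (new t)) (∑ gs (old t)))
                    (cong₂ (λ x y → x - q ⋆ y) (average-new t) (average-old t)))) ⟩
      ∑[ t ← allFin r ] (edgeWeight ⋆ (W ⋆ S) - q ⋆ (W ⋆ (R ⋆ weight χ id)))
        ≡⟨ trans (∑-const (allFin r) _) (cong (_⋆ (edgeWeight ⋆ (W ⋆ S) - q ⋆ (W ⋆ (R ⋆ weight χ id)))) (length-allFin r)) ⟩
      R ⋆ (edgeWeight ⋆ (W ⋆ S) - q ⋆ (W ⋆ (R ⋆ weight χ id))) ∎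
      where
      open ≡-Reasoning
      new old : Fin r → Vec (Position m r) r → ℤ
      new t g = copyWeight χ (moved g t)
      old t g = copyWeight χ (λ a → copyOf g t , a)
      distrib : ∀ q x y → q ⋆ q ⋆ (x - y) ≡ q ⋆ q ⋆ x - q ⋆ (q ⋆ y)
      distrib = solve-∀

-- Tuples that repeat a copy

distinct : ∀ {r} → Fin r → Fin r → ℤ
distinct u v = ⟦ ¬? (u Finₚ.≟ v) ⟧

#distinct : ℕ → ℤ
#distinct r = ∑[ u ← allFin r ] ∑[ v ← allFin r ] distinct u v

#distinct≤ : ∀ r → #distinct r ≤ℤ + r ⋆ + r
#distinct≤ r = subst (#distinct r ≤ℤ_)
  (cong₂ _⋆_ (length-allFin r) (trans (ℤₚ.*-identityʳ _) (length-allFin r)))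
  (∑-≤-const (allFin r) _ (λ u → ∑-≤-const (allFin r) 1ℤ (λ v → ⟦⟧≤1 (¬? (u Finₚ.≟ v)))))

module _ {m r : ℕ} .{{_ : NonZero r}} where

  private
    ps : List (Position m r)
    ps = positions m r

    gs : List (Vec (Position m r) r)
    gs = tuples ps r

    q : ℤ
    q = + length ps

  -- Vanishes exactly when g chooses r different copies.
  collisions : Vec (Position m r) r → ℤ
  collisions g = ∑[ u ← allFin r ] ∑[ v ← allFin r ] (distinct u v ⋆ ⟦ copyOf g u Finₚ.≟ copyOf g v ⟧)

  private
    0≤collision : ∀ (g : Vec (Position m r) r) u v → 0ℤ ≤ℤ distinct u v ⋆ ⟦ copyOf g u Finₚ.≟ copyOf g v ⟧
    0≤collision g u v = *-nonNeg (0≤⟦⟧ (¬? (u Finₚ.≟ v))) (0≤⟦⟧ (copyOf g u Finₚ.≟ copyOf g v))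

  collisions-nonNeg : ∀ g → 0ℤ ≤ℤ collisions g
  collisions-nonNeg g = ∑-nonNeg (allFin r) (λ u → ∑-nonNeg (allFin r) (0≤collision g u))

  injective-or-collides : ∀ g → Injective _≡_ _≡_ (copyOf g) ⊎ 1ℤ ≤ℤ collisions g
  injective-or-collides g with Finₚ.any? (λ u → Finₚ.any? (λ v → ¬? (u Finₚ.≟ v) ×-dec (copyOf g u Finₚ.≟ copyOf g v)))
  ... | yes (u , v , u≢v , eq) = inj₂ (begin
    1ℤ
      ≡⟨ sym (cong₂ _⋆_ (⟦⟧-yes (¬? (u Finₚ.≟ v)) u≢v) (⟦⟧-yes (copyOf g u Finₚ.≟ copyOf g v) eq)) ⟩
    distinct u v ⋆ ⟦ copyOf g u Finₚ.≟ copyOf g v ⟧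
      ≤⟨ ≤-∑ v (0≤collision g u) ⟩
    ∑[ v ← allFin r ] (distinct u v ⋆ ⟦ copyOf g u Finₚ.≟ copyOf g v ⟧)
      ≤⟨ ≤-∑ u (λ u → ∑-nonNeg (allFin r) (0≤collision g u)) ⟩
    collisions g ∎)
    where open ℤₚ.≤-Reasoning
  ... | no ∄ = inj₁ inj
    where
    inj : Injective _≡_ _≡_ (copyOf g)
    inj {u} {v} eq with u Finₚ.≟ v
    ... | yes u≡v = u≡v
    ... | no u≢v  = contradiction (u , v , u≢v , eq) ∄

  -- Two coordinates name the same copy with probability r / q, so the mean is `#distinct r` r / q,
  -- of the order of the drift.
  average-collisions : q ⋆ q ⋆ ∑ gs collisions ≡ #distinct r ⋆ + r ⋆ (+ length gs ⋆ q)
  average-collisions = begin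
    q ⋆ q ⋆ ∑ gs collisions
      ≡⟨ cong (q ⋆ q ⋆_) (trans (∑-comm gs (allFin r) _) (∑-cong (allFin r) (λ u → ∑-comm gs (allFin r) _))) ⟩
    q ⋆ q ⋆ ∑[ u ← allFin r ] ∑[ v ← allFin r ] ∑[ g ← gs ] (distinct u v ⋆ ⟦ copyOf g u Finₚ.≟ copyOf g v ⟧)
      ≡⟨ trans (sym (∑-*ˡ (allFin r) (q ⋆ q) _)) (∑-cong (allFin r) (λ u → sym (∑-*ˡ (allFin r) (q ⋆ q) _))) ⟩
    ∑[ u ← allFin r ] ∑[ v ← allFin r ] (q ⋆ q ⋆ ∑[ g ← gs ] (distinct u v ⋆ ⟦ copyOf g u Finₚ.≟ copyOf g v ⟧))
      ≡⟨ ∑-cong (allFin r) (λ u → ∑-cong (allFin r) (pair u)) ⟩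
    ∑[ u ← allFin r ] ∑[ v ← allFin r ] (distinct u v ⋆ (+ length gs ⋆ (q ⋆ + r)))
      ≡⟨ trans (∑-cong (allFin r) (λ u → ∑-*ʳ (allFin r) _ (distinct u))) (∑-*ʳ (allFin r) _ _) ⟩
    #distinct r ⋆ (+ length gs ⋆ (q ⋆ + r))
      ≡⟨ rearrange (#distinct r) (+ length gs) q (+ r) ⟩
    #distinct r ⋆ + r ⋆ (+ length gs ⋆ q) ∎
    where
    open ≡-Reasoning
    rearrange : ∀ c W q R → c ⋆ (W ⋆ (q ⋆ R)) ≡ c ⋆ R ⋆ (W ⋆ q)
    rearrange = solve-∀
    pull : ∀ a c s → a ⋆ (c ⋆ s) ≡ c ⋆ (a ⋆ s)
    pull = solve-∀
    same-copy : ∀ x → ∑[ y ← ps ] ⟦ proj₁ {B = λ _ → Fin r} x Finₚ.≟ proj₁ y ⟧ ≡ + r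
    same-copy (j , _) = begin
      ∑[ y ← ps ] ⟦ j Finₚ.≟ proj₁ y ⟧
        ≡⟨ ∑-positions m r _ ⟩
      ∑[ j′ ← allFin m ] ∑ (allFin r) (λ _ → ⟦ j Finₚ.≟ j′ ⟧)
        ≡⟨ ∑-cong (allFin m) (λ j′ → trans (∑-const (allFin r) _)
             (trans (cong₂ _⋆_ (length-allFin r) (⟦⟧-cong (j Finₚ.≟ j′) (j′ Finₚ.≟ j) sym sym)) (ℤₚ.*-comm (+ r) ⟦ j′ Finₚ.≟ j ⟧))) ⟩
      ∑[ j′ ← allFin m ] (⟦ j′ Finₚ.≟ j ⟧ ⋆ + r)
        ≡⟨ allFin-enumerates m j (λ _ → + r) ⟩
      + r ∎
    pair : ∀ u v → q ⋆ q ⋆ ∑[ g ← gs ] (distinct u v ⋆ ⟦ copyOf g u Finₚ.≟ copyOf g v ⟧) ≡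
                   distinct u v ⋆ (+ length gs ⋆ (q ⋆ + r))
    pair u v = trans (cong (q ⋆ q ⋆_) (∑-*ˡ gs (distinct u v) _))
      (trans (pull (q ⋆ q) (distinct u v) _) (cases (u Finₚ.≟ v)))
      where
      cases : (d : Dec (u ≡ v)) →
              ⟦ ¬? d ⟧ ⋆ (q ⋆ q ⋆ ∑[ g ← gs ] ⟦ copyOf g u Finₚ.≟ copyOf g v ⟧) ≡
              ⟦ ¬? d ⟧ ⋆ (+ length gs ⋆ (q ⋆ + r))
      cases (yes _)   = refl
      cases (no u≢v) = cong (1ℤ ⋆_) (trans
        (∑-tuples-lookup₂ ps r u≢v (λ x y → ⟦ proj₁ x Finₚ.≟ proj₁ y ⟧))
        (cong (+ length gs ⋆_) (trans (∑-cong ps same-copy) (∑-const ps (+ r)))))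

-- Lets the descent decide whether an improving move exists.
any-Vec? : ∀ {A : Set} → (∀ {Q : A → Set} → (∀ a → Dec (Q a)) → Dec (∃ Q)) →
           ∀ {n} {Q : Vec A n → Set} → (∀ v → Dec (Q v)) → Dec (∃ Q)
any-Vec? any-A? {zero}  Q? = map′ ([] ,_) (λ { ([] , q) → q }) (Q? [])
any-Vec? any-A? {suc n} Q? = map′ (λ (a , v , q) → a ∷ v , q) (λ { (a ∷ v , q) → a , v , q })
  (any-A? (λ a → any-Vec? any-A? (λ v → Q? (a ∷ v))))

any-Position? : ∀ {m r} {Q : Position m r → Set} → (∀ x → Dec (Q x)) → Dec (∃ Q)
any-Position? Q? = map′ (λ (j , a , q) → (j , a) , q) (λ ((j , a) , q) → j , a , q)
  (Finₚ.any? (λ j → Finₚ.any? (λ a → Q? (j , a))))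

-- d = r³ bounds the change of a (doubled) colour count under a move, and 4kd is the
-- accuracy required of the simultaneous approximation.
discrepancyBound : ℕ → ℕ → ℕ
discrepancyBound k r = (4 * k * d) ^ k * (k * (k * (d * d)) ℕ.+ 2 * (r * r * (k * d ℕ.+ 1)))
  where
  d = r * (r * r)

-- Descent on the sum of squared deviations

module Descent {k m r : ℕ} .{{_ : NonZero k}} .{{_ : NonZero m}} .{{_ : NonZero r}} (h : Fin r → Fin r → ℤ)
               (0≤h : ∀ a b → 0ℤ ≤ℤ h a b) (h≤1 : ∀ a b → h a b ≤ℤ 1ℤ) (h-irrefl : ∀ a → h a a ≡ 0ℤ)
               where

  open Weights {m} {r} h

  Colours : Set
  Colours = Fin k → Position m r → Position m r → ℤ

  private
    ps : List (Position m r)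
    ps = positions m r

    gs : List (Vec (Position m r) r)
    gs = tuples ps r

    is : List (Fin k)
    is = allFin k

    q W R K D : ℤ
    q = + length ps
    W = + length gs
    R = + r
    K = + k
    D = R ⋆ (R ⋆ R)

  -- What the descent uses of a balanced colouring. Both fields are invariant under bijections of
  -- the positions, so they persist along the descent.
  record Admissible (χ : Colours) : Set where
    field
      unit     : ∀ i → Unit (χ i)
      balanced : ∀ i → K ⋆ ∑[ x ← ps ] ∑[ y ← ps ] χ i x y ≡ q ⋆ (q - 1ℤ)

  -- A weight sums over ordered pairs, so this is 2k times the deviation of the paper.
  deviation : Colours → Fin k → ℤ
  deviation χ i = K ⋆ weight (χ i) id - + m ⋆ edgeWeight

  discrepancy potential : Colours → ℤ
  discrepancy χ = ∑[ i ← is ] ∥ deviation χ i ∥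
  potential χ = ∑[ i ← is ] (deviation χ i ⋆ deviation χ i)

  _∘₂_ : Colours → (Position m r → Position m r) → Colours
  (χ ∘₂ σ) i x y = χ i (σ x) (σ y)

  record Rearrangement : Set where
    field
      to from : Position m r → Position m r
      to-from : ∀ x → to (from x) ≡ x
      from-to : ∀ x → from (to x) ≡ x

  open Rearrangement

  ∘₂-admissible : ∀ {χ} → Admissible χ → (σ : Rearrangement) → Admissible (χ ∘₂ to σ)
  ∘₂-admissible {χ} adm σ = record
    { unit     = λ i x y → unit i (to σ x) (to σ y)
    ; balanced = λ i → trans (cong (K ⋆_)
        (trans (∑-cong ps (λ x → reindex (χ i (to σ x)))) (reindex (λ x → ∑ ps (χ i x))))) (balanced i)
    }
    where
    open Admissible adm
    reindex : (f : Position m r → ℤ) → ∑ ps (f ∘ to σ) ≡ ∑ ps f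
    reindex = ∑-reindex _≟ₚ_ _≟ₚ_ ps ps (positions-enumerates m r) (positions-enumerates m r)
      (to σ) (from σ) (to-from σ) (from-to σ)

  module _ {χ : Colours} (adm : Admissible χ) where

    open Admissible adm

    private
      y : Fin k → ℤ
      y = deviation χ

      0<K : 0ℤ <ℤ K
      0<K = +<+ (ℕ.>-nonZero⁻¹ k)

      0<q : 0ℤ <ℤ q
      0<q = subst (0ℤ <ℤ_) (trans (ℤₚ.pos-* m r) (sym (length-positions m r)))
        (+<+ (ℕ.>-nonZero⁻¹ (m * r) {{ℕₚ.m*n≢0 m r}}))

      0≤K : 0ℤ ≤ℤ K
      0≤K = ℤₚ.<⇒≤ 0<K

      0≤D : 0ℤ ≤ℤ D
      0≤D = *-nonNeg {R} (+≤+ z≤n) (*-nonNeg {R} {R} (+≤+ z≤n) (+≤+ z≤n))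

      0<qW : 0ℤ <ℤ W ⋆ q
      0<qW = subst (_<ℤ W ⋆ q) (ℤₚ.*-zeroʳ W)
        (ℤₚ.*-monoˡ-<-pos W {{ℤ.positive (#tuples-pos ps 0<q r)}} 0<q)

      -- If K S were q², the mean change would be an exact multiple of - yᵢ. Balancedness gives q (q
      -- - 1), because pairs of equal positions have no colour, and this leaves the error
      -- `edgeWeight`.
      average-deviation : ∀ i → q ⋆ q ⋆ K ⋆ ∑[ g ← gs ] Δ (χ i) g ≡
                                - (W ⋆ q ⋆ R ⋆ (R ⋆ y i + edgeWeight))
      average-deviation i = begin
        q ⋆ q ⋆ K ⋆ ∑[ g ← gs ] Δ (χ i) g
          ≡⟨ pull q K (∑ gs (Δ (χ i))) ⟩
        K ⋆ (q ⋆ q ⋆ ∑[ g ← gs ] Δ (χ i) g)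
          ≡⟨ cong (K ⋆_) (average-Δ h-irrefl (χ i)) ⟩
        K ⋆ (R ⋆ (edgeWeight ⋆ (W ⋆ S) - q ⋆ (W ⋆ (R ⋆ x))))
          ≡⟨ isolate K R edgeWeight W S q x ⟩
        R ⋆ W ⋆ (edgeWeight ⋆ (K ⋆ S) - q ⋆ (R ⋆ (K ⋆ x)))
          ≡⟨ cong (λ z → R ⋆ W ⋆ (edgeWeight ⋆ z - q ⋆ (R ⋆ (K ⋆ x)))) (balanced i) ⟩
        R ⋆ W ⋆ (edgeWeight ⋆ (q ⋆ (q - 1ℤ)) - q ⋆ (R ⋆ (K ⋆ x)))
          ≡⟨ cong (λ z → R ⋆ W ⋆ (edgeWeight ⋆ (q ⋆ (z - 1ℤ)) - q ⋆ (R ⋆ (K ⋆ x)))) (length-positions m r) ⟩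
        R ⋆ W ⋆ (edgeWeight ⋆ (q ⋆ (+ m ⋆ R - 1ℤ)) - q ⋆ (R ⋆ (K ⋆ x)))
          ≡⟨ collect R W edgeWeight q (+ m) (K ⋆ x) ⟩
        - (W ⋆ q ⋆ R ⋆ (R ⋆ y i + edgeWeight)) ∎
        where
        open ≡-Reasoning
        S = ∑[ x ← ps ] ∑[ y ← ps ] χ i x y
        x = weight (χ i) id
        pull : ∀ q K s → q ⋆ q ⋆ K ⋆ s ≡ K ⋆ (q ⋆ q ⋆ s)
        pull = solve-∀
        isolate : ∀ K R e W S q x → K ⋆ (R ⋆ (e ⋆ (W ⋆ S) - q ⋆ (W ⋆ (R ⋆ x)))) ≡
                                    R ⋆ W ⋆ (e ⋆ (K ⋆ S) - q ⋆ (R ⋆ (K ⋆ x)))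
        isolate = solve-∀
        collect : ∀ R W e q m x → R ⋆ W ⋆ (e ⋆ (q ⋆ (m ⋆ R - 1ℤ)) - q ⋆ (R ⋆ x)) ≡
                                  - (W ⋆ q ⋆ R ⋆ (R ⋆ (x - m ⋆ e) + e))
        collect = solve-∀

      G : ℤ
      G = K ⋆ (K ⋆ (D ⋆ D))

      -- Phrased through `collisions`, so that deciding it is a comparison of integers.
      Improving : Vec (Position m r) r → Set
      Improving g = ¬ (1ℤ ≤ℤ collisions g) × potential (χ ∘₂ move g) <ℤ potential χ

      improving? : ∀ g → Dec (Improving g)
      improving? g = ¬? (1ℤ ℤₚ.≤? collisions g) ×-dec (potential (χ ∘₂ move g) ℤₚ.<? potential χ)

      non-collision⇒injective : ∀ (g : Vec (Position m r) r) → ¬ (1ℤ ≤ℤ collisions g) → Injective _≡_ _≡_ (copyOf g)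
      non-collision⇒injective g ¬c with injective-or-collides g
      ... | inj₁ inj = inj
      ... | inj₂ c   = contradiction c ¬c

      -- The potential changes by 2 K ∑ yᵢ Δᵢ + K² ∑ Δᵢ². As |Δᵢ| ≤ D, the quadratic part is at most
      -- K³ D², and dividing by K leaves `G`.
      stable⇒bound : ∀ g → Injective _≡_ _≡_ (copyOf g) → potential χ ≤ℤ potential (χ ∘₂ move g) →
                     - G ≤ℤ + 2 ⋆ ∑[ i ← is ] (y i ⋆ Δ (χ i) g)
      stable⇒bound g inj stable = ℤₚ.*-cancelˡ-≤-pos (- G) (+ 2 ⋆ Y) K {{ℤ.positive 0<K}}
        (≤-by ((potential (χ ∘₂ move g) - potential χ) + K ⋆ K ⋆ (K ⋆ (D ⋆ D) - ΔΔ))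
          (ℤₚ.+-mono-≤ (ℤₚ.i≤j⇒0≤j-i stable) (*-nonNeg (*-nonNeg 0≤K 0≤K) (ℤₚ.i≤j⇒0≤j-i ΔΔ≤)))
          (trans (identity K Y (D ⋆ D) ΔΔ (potential χ))
                 (cong (λ z → z - potential χ + K ⋆ K ⋆ (K ⋆ (D ⋆ D) - ΔΔ)) (sym expand))))
        where
        δ : Fin k → ℤ
        δ i = Δ (χ i) g
        Y ΔΔ : ℤ
        Y = ∑[ i ← is ] (y i ⋆ δ i)
        ΔΔ = ∑[ i ← is ] (δ i ⋆ δ i)
        identity : ∀ K Y D Z P → K ⋆ (+ 2 ⋆ Y) - K ⋆ (- (K ⋆ (K ⋆ D))) ≡
                   (P + (+ 2 ⋆ K ⋆ Y + K ⋆ K ⋆ Z)) - P + K ⋆ K ⋆ (K ⋆ D - Z)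
        identity = solve-∀
        ΔΔ≤ : ΔΔ ≤ℤ K ⋆ (D ⋆ D)
        ΔΔ≤ = subst (λ l → ΔΔ ≤ℤ l ⋆ (D ⋆ D)) (length-allFin k) (∑-≤-const is (D ⋆ D)
          (λ i → subst (_≤ℤ D ⋆ D) (∥i∥∥i∥≡i*i (δ i))
            (*-mono-nonNeg 0≤D (0≤∥∥ (δ i)) (∥Δ∥≤ 0≤h h≤1 (χ i) (unit i) g) (∥Δ∥≤ 0≤h h≤1 (χ i) (unit i) g))))
        step : ∀ i → deviation (χ ∘₂ move g) i ≡ y i + K ⋆ δ i
        step i = trans (cong (λ w → K ⋆ w - + m ⋆ edgeWeight) (weight-move (χ i) g inj))
          (distrib K (weight (χ i) id) (δ i) (+ m ⋆ edgeWeight))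
          where
          distrib : ∀ K w d e → K ⋆ (w + d) - e ≡ K ⋆ w - e + K ⋆ d
          distrib = solve-∀
        expand : potential (χ ∘₂ move g) ≡ potential χ + (+ 2 ⋆ K ⋆ Y + K ⋆ K ⋆ ΔΔ)
        expand = begin
          potential (χ ∘₂ move g)
            ≡⟨ ∑-cong is (λ i → trans (cong₂ _⋆_ (step i) (step i)) (square K (y i) (δ i))) ⟩
          ∑[ i ← is ] (y i ⋆ y i + (+ 2 ⋆ K ⋆ (y i ⋆ δ i) + K ⋆ K ⋆ (δ i ⋆ δ i)))
            ≡⟨ trans (∑-+ is _ _) (cong (_+_ (potential χ)) (trans (∑-+ is _ _)
                 (cong₂ _+_ (∑-*ˡ is (+ 2 ⋆ K) _) (∑-*ˡ is (K ⋆ K) _)))) ⟩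
          potential χ + (+ 2 ⋆ K ⋆ Y + K ⋆ K ⋆ ΔΔ) ∎
          where
          open ≡-Reasoning
          square : ∀ K y d → (y + K ⋆ d) ⋆ (y + K ⋆ d) ≡ y ⋆ y + (+ 2 ⋆ K ⋆ (y ⋆ d) + K ⋆ K ⋆ (d ⋆ d))
          square = solve-∀

      module _ (stable : ¬ ∃ Improving) where

        d Q M : ℕ
        d = r * (r * r)
        Q = 4 * k * d
        M = ∣ discrepancy χ ∣

        +d : + d ≡ D
        +d = trans (ℤₚ.pos-* r (r * r)) (cong (R ⋆_) (ℤₚ.pos-* r r))

        +Q : + Q ≡ + 4 ⋆ K ⋆ D
        +Q = trans (ℤₚ.pos-* (4 * k) d) (cong₂ _⋆_ (ℤₚ.pos-* 4 k) +d)

        +M : + M ≡ discrepancy χ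
        +M = ℤₚ.0≤i⇒+∣i∣≡i (∑-nonNeg is (λ i → 0≤∥∥ (y i)))

        instance
          d≢0 : NonZero d
          d≢0 = ℕₚ.m*n≢0 r (r * r) {{it}} {{ℕₚ.m*n≢0 r r}}
          4k≢0 : NonZero (4 * k)
          4k≢0 = ℕₚ.m*n≢0 4 k
          Q≢0 : NonZero Q
          Q≢0 = ℕₚ.m*n≢0 (4 * k) d

        4k≤Q : 4 * k ≤ Q
        4k≤Q = ℕₚ.m≤m*n (4 * k) d

        k≤Q : k ≤ Q
        k≤Q = ℕₚ.≤-trans (ℕₚ.m≤n*m k 4) 4k≤Q

        2≤Q : 2 ≤ Q
        2≤Q = ℕₚ.≤-trans (s≤s (s≤s z≤n)) (ℕₚ.≤-trans (ℕₚ.m≤m*n 4 k) 4k≤Q)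

        module _ (s : ℕ) (p : Fin k → ℤ) (1≤s : 1 ≤ s)
                 (close : ∀ i → + Q ⋆ ∥ + s ⋆ y i - + M ⋆ p i ∥ <ℤ + M)
                 (sG<M : + s ⋆ G <ℤ + M) where

          P₁ : ℤ
          P₁ = ∑[ i ← is ] ∥ p i ∥

          -- One approximation meets three demands: accuracy 1 / k makes p nonzero, 1 / 2 gives the
          -- pairing with y, and the full 1 / Q allows the rounding of ∑ pᵢ Δᵢ.
          weaken : ∀ {n} → n ≤ Q → ∀ i → + n ⋆ ∥ + s ⋆ y i - + M ⋆ p i ∥ <ℤ + M
          weaken n≤Q i = ℤₚ.≤-<-trans (*-monoʳ (0≤∥∥ (+ s ⋆ y i - + M ⋆ p i)) (+≤+ n≤Q)) (close i)

          is-length : + length is ≡ K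
          is-length = length-allFin k

          0<P₁ : 0ℤ <ℤ P₁
          0<P₁ = rounding-nonzero is y p {+ M} {+ s} (subst (0ℤ <ℤ_) (sym is-length) 0<K) (+≤+ 1≤s) +M (+≤+ z≤n)
            (λ i → subst (λ l → l ⋆ ∥ + s ⋆ y i - + M ⋆ p i ∥ <ℤ + M) (sym is-length) (weaken k≤Q i))

          0≤DP₁ : 0ℤ ≤ℤ D ⋆ P₁
          0≤DP₁ = *-nonNeg 0≤D (ℤₚ.<⇒≤ 0<P₁)

          -- Stability says nothing about a tuple with a repeated copy. There the crude bound ∑ pᵢ
          -- Δᵢ ≥ - D P₁ holds, and a single collision pays for it.
          almost-nonneg : ∀ g → 0ℤ ≤ℤ ∑[ i ← is ] (p i ⋆ Δ (χ i) g) + collisions g ⋆ (D ⋆ P₁)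
          almost-nonneg g with 1ℤ ℤₚ.≤? collisions g
          ... | no ¬c = ℤₚ.+-mono-≤
            (rounding-nonneg is y p {+ M} {+ s} (subst (0ℤ <ℤ_) (sym is-length) 0<K) (+≤+ z≤n) (+≤+ z≤n) {D} {G} 0≤D
              (λ i → Δ (χ i) g)
              (λ i → ∥Δ∥≤ 0≤h h≤1 (χ i) (unit i) g)
              (λ i → subst (_≤ℤ + M) (cong (_⋆ ∥ + s ⋆ y i - + M ⋆ p i ∥)
                       (trans +Q (cong (λ l → + 4 ⋆ l ⋆ D) (sym is-length)))) (ℤₚ.<⇒≤ (close i)))
              (stable⇒bound g (non-collision⇒injective g ¬c) (ℤₚ.≮⇒≥ (λ lt → stable (g , ¬c , lt))))
              sG<M)
            (*-nonNeg (collisions-nonNeg g) 0≤DP₁)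
          ... | yes c = ≤-by ((P + D ⋆ P₁) + (collisions g - 1ℤ) ⋆ (D ⋆ P₁))
            (ℤₚ.+-mono-≤ 0≤P+DP₁ (*-nonNeg (ℤₚ.i≤j⇒0≤j-i c) 0≤DP₁))
            (identity P (collisions g) (D ⋆ P₁))
            where
            P : ℤ
            P = ∑[ i ← is ] (p i ⋆ Δ (χ i) g)
            identity : ∀ P c x → P + c ⋆ x - 0ℤ ≡ (P + x) + (c - 1ℤ) ⋆ x
            identity = solve-∀
            term : ∀ i → 0ℤ ≤ℤ p i ⋆ Δ (χ i) g + D ⋆ ∥ p i ∥
            term i = begin
              0ℤ                                          ≤⟨ 0≤∥i∥+i (p i ⋆ Δ (χ i) g) ⟩
              ∥ p i ⋆ Δ (χ i) g ∥ + p i ⋆ Δ (χ i) g       ≡⟨ cong (_+ p i ⋆ Δ (χ i) g) (∥i*j∥ (p i) (Δ (χ i) g)) ⟩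
              ∥ p i ∥ ⋆ ∥ Δ (χ i) g ∥ + p i ⋆ Δ (χ i) g   ≤⟨ ℤₚ.+-monoˡ-≤ (p i ⋆ Δ (χ i) g)
                                                              (*-monoˡ (0≤∥∥ (p i)) (∥Δ∥≤ 0≤h h≤1 (χ i) (unit i) g)) ⟩
              ∥ p i ∥ ⋆ D + p i ⋆ Δ (χ i) g               ≡⟨ swap ∥ p i ∥ D (p i ⋆ Δ (χ i) g) ⟩
              p i ⋆ Δ (χ i) g + D ⋆ ∥ p i ∥               ∎
              where
              open ℤₚ.≤-Reasoning
              swap : ∀ n D x → n ⋆ D + x ≡ x + D ⋆ n
              swap = solve-∀
            0≤P+DP₁ : 0ℤ ≤ℤ P + D ⋆ P₁
            0≤P+DP₁ = subst (0ℤ ≤ℤ_) (trans (∑-+ is _ _) (cong (_+_ P) (∑-*ˡ is D _))) (∑-nonNeg is term)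

          discrepancy≤ : + M ≤ℤ + 2 ⋆ + s ⋆ (R ⋆ R ⋆ (K ⋆ D + 1ℤ))
          discrepancy≤ = averaging-bound is gs y p (λ i → Δ (χ i)) collisions
            {+ M} {+ s} {K} {D} {R} {edgeWeight} {W ⋆ q} {q ⋆ q} {#distinct r}
            average-deviation average-collisions 0<qW (+≤+ (ℕ.>-nonZero⁻¹ r)) (+≤+ z≤n) (+≤+ z≤n)
            (*-nonNeg {q} {q} (+≤+ z≤n) (+≤+ z≤n)) 0≤K 0≤D
            (edgeWeight-nonNeg 0≤h h≤1) (edgeWeight≤ 0≤h h≤1) (#distinct≤ r)
            0<P₁
            (λ i → nearest-pairing {+ M} {+ s} (y i) (p i) (+≤+ z≤n) (ℤₚ.<⇒≤ (weaken 2≤Q i)))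
            almost-nonneg

        G′ B : ℕ
        G′ = k * (k * (d * d))
        B = r * r * (k * d ℕ.+ 1)

        +G : + G′ ≡ G
        +G = begin
          + (k * (k * (d * d)))      ≡⟨ ℤₚ.pos-* k (k * (d * d)) ⟩
          K ⋆ + (k * (d * d))        ≡⟨ cong (K ⋆_) (ℤₚ.pos-* k (d * d)) ⟩
          K ⋆ (K ⋆ + (d * d))        ≡⟨ cong (λ z → K ⋆ (K ⋆ z)) (ℤₚ.pos-* d d) ⟩
          K ⋆ (K ⋆ (+ d ⋆ + d))      ≡⟨ cong (λ z → K ⋆ (K ⋆ (z ⋆ z))) +d ⟩
          K ⋆ (K ⋆ (D ⋆ D))          ∎
          where open ≡-Reasoning

        +B : + B ≡ R ⋆ R ⋆ (K ⋆ D + 1ℤ)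
        +B = begin
          + (r * r * (k * d ℕ.+ 1))       ≡⟨ ℤₚ.pos-* (r * r) (k * d ℕ.+ 1) ⟩
          + (r * r) ⋆ (+ (k * d) + 1ℤ)    ≡⟨ cong₂ (λ u v → u ⋆ (v + 1ℤ)) (ℤₚ.pos-* r r) (ℤₚ.pos-* k d) ⟩
          R ⋆ R ⋆ (K ⋆ + d + 1ℤ)          ≡⟨ cong (λ z → R ⋆ R ⋆ (K ⋆ z + 1ℤ)) +d ⟩
          R ⋆ R ⋆ (K ⋆ D + 1ℤ)            ∎
          where open ≡-Reasoning

        -- Suppose M exceeds the bound. Then M > 0, and the summand `G′` gives s `G` < M, as the
        -- rounding requires. Averaging now yields M ≤ 2 s `B`, which the other summand covers
        -- because s ≤ Q ^ k.
        M≤bound : M ≤ discrepancyBound k r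
        M≤bound = ℕₚ.≮⇒≥ (λ bound<M → ℕₚ.<⇒≱ bound<M (M≤ bound<M))
          where
          M≤ : discrepancyBound k r ℕ.< M → M ≤ discrepancyBound k r
          M≤ bound<M = fromApproximation (dirichlet k Q M {{it}} {{ℕ.>-nonZero 0<M}} y)
            where
            0<M : 0 ℕ.< M
            0<M = ℕₚ.≤-<-trans z≤n bound<M

            fromApproximation : ∃[ s ] Σ[ p ∈ (Fin k → ℤ) ] (1 ≤ s × s ≤ Q ^ k ×
                                  (∀ i → + Q ⋆ ∥ + s ⋆ y i - + M ⋆ p i ∥ <ℤ + M)) →
                                M ≤ discrepancyBound k r
            fromApproximation (s , p , 1≤s , s≤ , close) = ℕₚ.≤-trans
              (ℤₚ.drop‿+≤+ {M} {s * (2 * B)} (subst (+ M ≤ℤ_) eq (discrepancy≤ s p 1≤s close sG<M)))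
              (ℕₚ.*-mono-≤ s≤ (ℕₚ.m≤n+m (2 * B) G′))
              where
              open ≡-Reasoning
              sG<M : + s ⋆ G <ℤ + M
              sG<M = subst (_<ℤ + M) (trans (ℤₚ.pos-* s G′) (cong (+ s ⋆_) +G))
                (+<+ (ℕₚ.≤-<-trans (ℕₚ.*-mono-≤ s≤ (ℕₚ.m≤m+n G′ (2 * B))) bound<M))
              rearrange : ∀ s b → + 2 ⋆ s ⋆ b ≡ s ⋆ (+ 2 ⋆ b)
              rearrange = solve-∀
              eq : + 2 ⋆ + s ⋆ (R ⋆ R ⋆ (K ⋆ D + 1ℤ)) ≡ + (s * (2 * B))
              eq = begin
                + 2 ⋆ + s ⋆ (R ⋆ R ⋆ (K ⋆ D + 1ℤ))  ≡⟨ cong (+ 2 ⋆ + s ⋆_) (sym +B) ⟩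
                + 2 ⋆ + s ⋆ + B                     ≡⟨ rearrange (+ s) (+ B) ⟩
                + s ⋆ (+ 2 ⋆ + B)                   ≡⟨ cong (+ s ⋆_) (sym (ℤₚ.pos-* 2 B)) ⟩
                + s ⋆ + (2 * B)                     ≡⟨ sym (ℤₚ.pos-* s (2 * B)) ⟩
                + (s * (2 * B))                     ∎

    improve : discrepancy χ ≤ℤ + discrepancyBound k r ⊎
              Σ[ σ ∈ Rearrangement ] potential (χ ∘₂ to σ) <ℤ potential χ
    improve with any-Vec? any-Position? improving?
    ... | no stable = inj₁ (subst (_≤ℤ + discrepancyBound k r) (+M stable) (+≤+ (M≤bound stable)))
    ... | yes (g , ¬c , better) = inj₂ (record
      { to = move g ; from = move⁻¹ g ; to-from = move-move⁻¹ g inj ; from-to = move⁻¹-move g inj } , better)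
      where
      inj = non-collision⇒injective g ¬c

  private
    identity : Rearrangement
    identity = record { to = id ; from = id ; to-from = λ _ → refl ; from-to = λ _ → refl }

    _∙_ : Rearrangement → Rearrangement → Rearrangement
    σ ∙ τ = record
      { to      = to σ ∘ to τ
      ; from    = from τ ∘ from σ
      ; to-from = λ x → trans (cong (to σ) (to-from τ (from σ x))) (to-from σ x)
      ; from-to = λ x → trans (cong (from τ) (from-to σ (to τ x))) (from-to τ x)
      }

    -- The potential is a sum of integer squares, hence a natural number that drops with every
    -- improvement.
    descend : ∀ χ → Admissible χ → Acc ℕ._<_ ∣ potential χ ∣ →
              Σ[ σ ∈ Rearrangement ] discrepancy (χ ∘₂ to σ) ≤ℤ + discrepancyBound k r
    descend χ adm (acc rec) with improve adm
    ... | inj₁ small = identity , small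
    ... | inj₂ (σ , better) with descend (χ ∘₂ to σ) (∘₂-admissible adm σ) (rec (ℤₚ.drop‿+<+
            (subst₂ _<ℤ_ (sym (potential-abs (χ ∘₂ to σ))) (sym (potential-abs χ)) better)))
      where
      potential-abs : ∀ χ → ∥ potential χ ∥ ≡ potential χ
      potential-abs χ = ℤₚ.0≤i⇒+∣i∣≡i (∑-nonNeg is (λ i → 0≤i*i (deviation χ i)))
    ...   | τ , small = σ ∙ τ , small

  small-discrepancy : ∀ χ → Admissible χ →
                      Σ[ σ ∈ Rearrangement ] discrepancy (χ ∘₂ to σ) ≤ℤ + discrepancyBound k r
  small-discrepancy χ adm = descend χ adm (<-wellFounded ∣ potential χ ∣)

-- Counting edges

count-++ : ∀ {A : Set} {Q : A → Set} (Q? : ∀ a → Dec (Q a)) xs ys →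
           + length (filter Q? (xs ++ ys)) ≡ + length (filter Q? xs) + + length (filter Q? ys)
count-++ Q? xs ys = trans
  (cong (λ zs → + length zs) (Listₚ.filter-++ Q? xs ys))
  (cong +_ (Listₚ.length-++ (filter Q? xs)))

count-concatMap : ∀ {A B : Set} {Q : B → Set} (Q? : ∀ b → Dec (Q b)) (f : A → List B) xs →
                  + length (filter Q? (concatMap f xs)) ≡ ∑[ x ← xs ] (+ length (filter Q? (f x)))
count-concatMap Q? f []       = refl
count-concatMap Q? f (x ∷ xs) = trans (count-++ Q? (f x) (concatMap f xs))
  (cong (_+_ (+ length (filter Q? (f x)))) (count-concatMap Q? f xs))

count-mapMaybe : ∀ {A B : Set} {Q : B → Set} (Q? : ∀ b → Dec (Q b)) (f : A → Maybe B) xs →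
                 + length (filter Q? (mapMaybe f xs)) ≡ ∑[ x ← xs ] maybe′ (λ b → ⟦ Q? b ⟧) 0ℤ (f x)
count-mapMaybe Q? f [] = refl
count-mapMaybe Q? f (x ∷ xs) with f x
... | nothing = trans (count-mapMaybe Q? f xs) (sym (ℤₚ.+-identityˡ _))
... | just b with Q? b
...   | yes _ = trans (ℤₚ.pos-+ 1 _) (cong (_+_ 1ℤ) (count-mapMaybe Q? f xs))
...   | no _  = trans (count-mapMaybe Q? f xs) (sym (ℤₚ.+-identityˡ _))

onEdge : ∀ {N} → (Edge N → ℤ) → Fin N → Fin N → ℤ
onEdge f u v with u Finₚ.<? v
... | yes u<v = f (u , v , u<v)
... | no _    = 0ℤ

onEdge-< : ∀ {N} (f : Edge N → ℤ) {u v} (u<v : u Fin.< v) → onEdge f u v ≡ f (u , v , u<v)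
onEdge-< f {u} {v} u<v with u Finₚ.<? v
... | yes u<v′ = cong (λ p → f (u , v , p)) (Finₚ.<-irrelevant u<v′ u<v)
... | no u≮v   = contradiction u<v u≮v

onEdge-≮ : ∀ {N} (f : Edge N → ℤ) {u v} → ¬ u Fin.< v → onEdge f u v ≡ 0ℤ
onEdge-≮ f {u} {v} u≮v with u Finₚ.<? v
... | yes u<v = contradiction u<v u≮v
... | no _    = refl

-- At most one summand can be nonzero: off the diagonal this is the value of `f` at the unordered
-- pair, and on the diagonal it is 0.
onPair : ∀ {N} → (Edge N → ℤ) → Fin N → Fin N → ℤ
onPair f u v = onEdge f u v + onEdge f v u

-- The edge is fixed before `f`, so that the indicators of all colours are evaluated at the same
-- edge.
onPair-cases : ∀ {N} u v → u ≡ v ⊎ Σ[ e ∈ Edge N ] (∀ f → onPair f u v ≡ f e)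
onPair-cases u v with Finₚ.<-cmp u v
... | tri< u<v _ v≮u = inj₂ ((u , v , u<v) , λ f →
        trans (cong₂ _+_ (onEdge-< f u<v) (onEdge-≮ f v≮u)) (ℤₚ.+-identityʳ _))
... | tri≈ _ u≡v _   = inj₁ u≡v
... | tri> u≮v _ v<u = inj₂ ((v , u , v<u) , λ f →
        trans (cong₂ _+_ (onEdge-≮ f u≮v) (onEdge-< f v<u)) (ℤₚ.+-identityˡ _))

onPair-irrefl : ∀ {N} (f : Edge N → ℤ) u → onPair f u u ≡ 0ℤ
onPair-irrefl f u = cong₂ _+_ (onEdge-≮ f u≮u) (onEdge-≮ f u≮u)
  where
  u≮u : ¬ u Fin.< u
  u≮u = Finₚ.<-irrefl refl

∑-onPair : ∀ {N} (f : Edge N → ℤ) → ∑[ u ← allFin N ] ∑[ v ← allFin N ] onPair f u v ≡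
           + 2 ⋆ ∑[ u ← allFin N ] ∑[ v ← allFin N ] onEdge f u v
∑-onPair {N} f = begin
  ∑[ u ← allFin N ] ∑[ v ← allFin N ] (onEdge f u v + onEdge f v u)
    ≡⟨ trans (∑-cong (allFin N) (λ u → ∑-+ (allFin N) (onEdge f u) (λ v → onEdge f v u)))
             (∑-+ (allFin N) _ _) ⟩
  S + ∑[ u ← allFin N ] ∑[ v ← allFin N ] onEdge f v u
    ≡⟨ cong (_+_ S) (∑-comm (allFin N) (allFin N) (λ u v → onEdge f v u)) ⟩
  S + S
    ≡⟨ double S ⟩
  + 2 ⋆ S ∎
  where
  open ≡-Reasoning
  S = ∑[ u ← allFin N ] ∑[ v ← allFin N ] onEdge f u v
  double : ∀ s → s + s ≡ + 2 ⋆ s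
  double = solve-∀

count-edges : ∀ {N} {Q : Edge N → Set} (Q? : ∀ e → Dec (Q e)) →
              + length (filter Q? (edges N)) ≡
              ∑[ u ← allFin N ] ∑[ v ← allFin N ] onEdge (λ e → ⟦ Q? e ⟧) u v
count-edges {N} Q? = trans (count-concatMap Q? _ (allFin N))
  (∑-cong (allFin N) (λ u → trans (count-mapMaybe Q? _ (allFin N)) (∑-cong (allFin N) (λ v → entry u v))))
  where
  entry : ∀ u v → maybe′ (λ e → ⟦ Q? e ⟧) 0ℤ (Maybe.map (λ u<v → u , v , u<v) (dec⇒maybe (u Finₚ.<? v)))
                  ≡ onEdge (λ e → ⟦ Q? e ⟧) u v
  entry u v with u Finₚ.<? v
  ... | yes _ = refl
  ... | no _  = refl

-- Colour counts as sums over ordered pairs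

module _ {k N : ℕ} (c : Colouring k N) where

  private
    vs : List (Fin N)
    vs = allFin N

    is : List (Fin k)
    is = allFin k

    colourIs : Fin k → Edge N → ℤ
    colourIs i e = ⟦ c e Finₚ.≟ i ⟧

    ∑-colourIs : ∀ e → ∑[ i ← is ] colourIs i e ≡ 1ℤ
    ∑-colourIs e = trans
      (∑-cong is (λ i → trans (⟦⟧-cong (c e Finₚ.≟ i) (i Finₚ.≟ c e) sym sym) (sym (ℤₚ.*-identityʳ ⟦ i Finₚ.≟ c e ⟧))))
      (allFin-enumerates k (c e) (λ _ → 1ℤ))

  colourOf : Fin k → Fin N → Fin N → ℤ
  colourOf i = onPair (colourIs i)

  0≤colourOf : ∀ i u v → 0ℤ ≤ℤ colourOf i u v
  0≤colourOf i u v with onPair-cases u v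
  ... | inj₁ refl     = ℤₚ.≤-reflexive (sym (onPair-irrefl (colourIs i) u))
  ... | inj₂ (e , eq) = subst (0ℤ ≤ℤ_) (sym (eq (colourIs i))) (0≤⟦⟧ (c e Finₚ.≟ i))

  colourOf≤1 : ∀ i u v → colourOf i u v ≤ℤ 1ℤ
  colourOf≤1 i u v with onPair-cases u v
  ... | inj₁ refl     = ℤₚ.≤-trans (ℤₚ.≤-reflexive (onPair-irrefl (colourIs i) u)) (+≤+ z≤n)
  ... | inj₂ (e , eq) = subst (_≤ℤ 1ℤ) (sym (eq (colourIs i))) (⟦⟧≤1 (c e Finₚ.≟ i))

  ∑-colourOf-≢ : ∀ {u v} → u ≢ v → ∑[ i ← is ] colourOf i u v ≡ 1ℤ
  ∑-colourOf-≢ {u} {v} u≢v with onPair-cases u v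
  ... | inj₁ u≡v      = contradiction u≡v u≢v
  ... | inj₂ (e , eq) = trans (∑-cong is (λ i → eq (colourIs i))) (∑-colourIs e)

  ∑-colourOf : ∀ u v → ∑[ i ← is ] colourOf i u v ≡ 1ℤ - ⟦ v Finₚ.≟ u ⟧
  ∑-colourOf u v with v Finₚ.≟ u
  ... | yes refl = ∑-zero is (λ i → onPair-irrefl (colourIs i) u)
  ... | no v≢u   = ∑-colourOf-≢ (v≢u ∘ sym)

  colourClassSize-onPair : ∀ i → ∑[ u ← vs ] ∑[ v ← vs ] colourOf i u v ≡ + 2 ⋆ + colourClassSize c i
  colourClassSize-onPair i = trans (∑-onPair (colourIs i)) (cong (+ 2 ⋆_) (sym (count-edges (λ e → c e Finₚ.≟ i))))

  -- By balancedness, k times one class is the sum over all classes, and the colour indicators of a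
  -- pair add up to 1 off the diagonal.
  balanced-colourOf : Balanced c → ∀ i → + k ⋆ ∑[ u ← vs ] ∑[ v ← vs ] colourOf i u v ≡ + N ⋆ (+ N - 1ℤ)
  balanced-colourOf bal i = begin
    + k ⋆ S i
      ≡⟨ cong (_⋆ S i) (sym (length-allFin k)) ⟩
    + length is ⋆ S i
      ≡⟨ sym (∑-const is (S i)) ⟩
    ∑[ j ← is ] S i
      ≡⟨ ∑-cong is (λ j → trans (colourClassSize-onPair i)
           (trans (cong (λ n → + 2 ⋆ + n) (bal i j)) (sym (colourClassSize-onPair j)))) ⟩
    ∑[ j ← is ] S j
      ≡⟨ trans (∑-comm is vs _) (∑-cong vs (λ u → ∑-comm is vs _)) ⟩
    ∑[ u ← vs ] ∑[ v ← vs ] ∑[ j ← is ] colourOf j u v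
      ≡⟨ ∑-cong vs (λ u → trans (∑-cong vs (∑-colourOf u)) (trans (∑-minus vs _ _) (cong₂ _-_ count (sift u)))) ⟩
    ∑[ u ← vs ] (+ N - 1ℤ)
      ≡⟨ trans (∑-const vs _) (cong (_⋆ (+ N - 1ℤ)) (length-allFin N)) ⟩
    + N ⋆ (+ N - 1ℤ) ∎
    where
    open ≡-Reasoning
    S : Fin k → ℤ
    S i = ∑[ u ← vs ] ∑[ v ← vs ] colourOf i u v
    count : ∑ vs (λ _ → 1ℤ) ≡ + N
    count = trans (∑-const vs 1ℤ) (trans (ℤₚ.*-identityʳ _) (length-allFin N))
    sift : ∀ u → ∑[ v ← vs ] ⟦ v Finₚ.≟ u ⟧ ≡ 1ℤ
    sift u = trans (∑-cong vs (λ v → sym (ℤₚ.*-identityʳ ⟦ v Finₚ.≟ u ⟧))) (allFin-enumerates N u (λ _ → 1ℤ))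

  module Placed {m r : ℕ} (H : SimpleGraph r) (placement : Position m r ↔ Fin N) where

    open SimpleGraph H using () renaming (Adj to _~_; adjacent? to _~?_)

    private
      place : Position m r → Fin N
      place = Inverse.to placement

      unplace : Fin N → Position m r
      unplace = Inverse.from placement

      place-unplace : ∀ v → place (unplace v) ≡ v
      place-unplace v = Inverse.inverseˡ placement refl

      unplace-place : ∀ x → unplace (place x) ≡ x
      unplace-place x = Inverse.inverseʳ placement refl

      -- The equation is oriented as in `Enumerates`, whose sum over `j′` it then collapses
      -- directly.
      AdjPosition : Position m r → Position m r → Set
      AdjPosition (j , a) (j′ , b) = j′ ≡ j × a ~ b

      adjPosition? : ∀ x y → Dec (AdjPosition x y)
      adjPosition? (j , a) (j′ , b) = (j′ Finₚ.≟ j) ×-dec (a ~? b)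

    factor : SimpleGraph N
    factor = record
      { Adj       = λ u v → AdjPosition (unplace u) (unplace v)
      ; symmetric = λ (eq , adj) → sym eq , SimpleGraph.symmetric H adj
      ; loopless  = λ v (_ , adj) → SimpleGraph.loopless H _ adj
      ; adjacent? = λ u v → adjPosition? (unplace u) (unplace v)
      }

    isFactor : IsFactor H factor
    isFactor = record
      { copies    = m
      ; placement = placement
      ; adjacency = λ u v → mk⇔
          (λ (eq , adj) → proj₁ (unplace u) , proj₂ (unplace u) , proj₂ (unplace v) , adj , place-unplace u ,
             trans (cong (λ j → place (j , proj₂ (unplace v))) (sym eq)) (place-unplace v))
          (λ { (j , a , b , adj , refl , refl) → subst₂ AdjPosition
             (sym (unplace-place (j , a))) (sym (unplace-place (j , b))) (refl , adj) })
      }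

    adjacency : Fin r → Fin r → ℤ
    adjacency a b = ⟦ a ~? b ⟧

    private
      inFactor : Fin N → Fin N → ℤ
      inFactor u v = ⟦ SimpleGraph.adjacent? factor u v ⟧

      inFactor-sym : ∀ u v → inFactor u v ≡ inFactor v u
      inFactor-sym u v = ⟦⟧-cong (SimpleGraph.adjacent? factor u v) (SimpleGraph.adjacent? factor v u)
        (SimpleGraph.symmetric factor {u} {v}) (SimpleGraph.symmetric factor {v} {u})

      ∑-inFactor : (f : Fin N → Fin N → ℤ) → ∑[ u ← vs ] ∑[ v ← vs ] (inFactor u v ⋆ f u v) ≡
        ∑[ j ← allFin m ] ∑[ a ← allFin r ] ∑[ b ← allFin r ] (adjacency a b ⋆ f (place (j , a)) (place (j , b)))
      ∑-inFactor f = begin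
        ∑[ u ← vs ] ∑[ v ← vs ] (inFactor u v ⋆ f u v)
          ≡⟨ sym (reindex _) ⟩
        ∑[ x ← ps ] ∑[ v ← vs ] (inFactor (place x) v ⋆ f (place x) v)
          ≡⟨ ∑-cong ps (λ x → sym (reindex _)) ⟩
        ∑[ x ← ps ] ∑[ y ← ps ] (inFactor (place x) (place y) ⋆ f (place x) (place y))
          ≡⟨ ∑-cong ps (λ x → ∑-cong ps (λ y → cong₂ (λ x′ y′ → ⟦ adjPosition? x′ y′ ⟧ ⋆ f (place x) (place y))
               (unplace-place x) (unplace-place y))) ⟩
        ∑[ x ← ps ] ∑[ y ← ps ] (⟦ adjPosition? x y ⟧ ⋆ f (place x) (place y))
          ≡⟨ ∑-positions m r _ ⟩
        ∑[ j ← allFin m ] ∑[ a ← allFin r ] ∑[ y ← ps ] (⟦ adjPosition? (j , a) y ⟧ ⋆ f (place (j , a)) (place y))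
          ≡⟨ ∑-cong (allFin m) (λ j → ∑-cong (allFin r) (λ a → sameCopy j a)) ⟩
        ∑[ j ← allFin m ] ∑[ a ← allFin r ] ∑[ b ← allFin r ] (adjacency a b ⋆ f (place (j , a)) (place (j , b))) ∎
        where
        open ≡-Reasoning
        ps : List (Position m r)
        ps = positions m r
        reindex : (g : Fin N → ℤ) → ∑ ps (g ∘ place) ≡ ∑ vs g
        reindex = ∑-reindex _≟ₚ_ Finₚ._≟_ ps vs (positions-enumerates m r) (allFin-enumerates N)
          place unplace place-unplace unplace-place
        sameCopy : ∀ j a → ∑[ y ← ps ] (⟦ adjPosition? (j , a) y ⟧ ⋆ f (place (j , a)) (place y)) ≡
                           ∑[ b ← allFin r ] (adjacency a b ⋆ f (place (j , a)) (place (j , b)))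
        sameCopy j a = begin
          ∑[ y ← ps ] (⟦ adjPosition? (j , a) y ⟧ ⋆ f (place (j , a)) (place y))
            ≡⟨ ∑-positions m r _ ⟩
          ∑[ j′ ← allFin m ] ∑[ b ← allFin r ] (⟦ adjPosition? (j , a) (j′ , b) ⟧ ⋆ f (place (j , a)) (place (j′ , b)))
            ≡⟨ ∑-cong (allFin m) (λ j′ → trans (∑-cong (allFin r) (λ b →
                 trans (cong (_⋆ f (place (j , a)) (place (j′ , b))) (⟦⟧-× (j′ Finₚ.≟ j) (a ~? b)))
                       (ℤₚ.*-assoc ⟦ j′ Finₚ.≟ j ⟧ (adjacency a b) (f (place (j , a)) (place (j′ , b))))))
                 (∑-*ˡ (allFin r) ⟦ j′ Finₚ.≟ j ⟧ _)) ⟩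
          ∑[ j′ ← allFin m ] (⟦ j′ Finₚ.≟ j ⟧ ⋆ ∑[ b ← allFin r ] (adjacency a b ⋆ f (place (j , a)) (place (j′ , b))))
            ≡⟨ allFin-enumerates m j _ ⟩
          ∑[ b ← allFin r ] (adjacency a b ⋆ f (place (j , a)) (place (j , b))) ∎

      onEdge-inFactor : ∀ (f : Edge N → ℤ) u v →
        onEdge (λ e → ⟦ e ∈E? factor ⟧ ⋆ f e) u v ≡ inFactor u v ⋆ onEdge f u v
      onEdge-inFactor f u v with u Finₚ.<? v
      ... | yes _ = refl
      ... | no _  = sym (ℤₚ.*-zeroʳ (inFactor u v))

    -- The right-hand side is the `weight` of the descent, unfolded for the rearranged placement.
    edgeCountInColour-placed : ∀ i → + 2 ⋆ + edgeCountInColour factor c i ≡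
      ∑[ j ← allFin m ] ∑[ a ← allFin r ] ∑[ b ← allFin r ] (adjacency a b ⋆ colourOf i (place (j , a)) (place (j , b)))
    edgeCountInColour-placed i = begin
      + 2 ⋆ + edgeCountInColour factor c i
        ≡⟨ cong (+ 2 ⋆_) (count-edges (λ e → (e ∈E? factor) ×-dec (c e Finₚ.≟ i))) ⟩
      + 2 ⋆ ∑[ u ← vs ] ∑[ v ← vs ] onEdge both u v
        ≡⟨ sym (∑-onPair both) ⟩
      ∑[ u ← vs ] ∑[ v ← vs ] onPair both u v
        ≡⟨ ∑-cong vs (λ u → ∑-cong vs (λ v → pair u v)) ⟩
      ∑[ u ← vs ] ∑[ v ← vs ] (inFactor u v ⋆ colourOf i u v)
        ≡⟨ ∑-inFactor (colourOf i) ⟩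
      ∑[ j ← allFin m ] ∑[ a ← allFin r ] ∑[ b ← allFin r ] (adjacency a b ⋆ colourOf i (place (j , a)) (place (j , b))) ∎
      where
      open ≡-Reasoning
      both : Edge N → ℤ
      both e = ⟦ (e ∈E? factor) ×-dec (c e Finₚ.≟ i) ⟧
      onEdge-cong : ∀ {f g : Edge N → ℤ} → (∀ e → f e ≡ g e) → ∀ u v → onEdge f u v ≡ onEdge g u v
      onEdge-cong eq u v with u Finₚ.<? v
      ... | yes u<v = eq (u , v , u<v)
      ... | no _    = refl
      half : ∀ u v → onEdge both u v ≡ inFactor u v ⋆ onEdge (colourIs i) u v
      half u v = trans (onEdge-cong (λ e → ⟦⟧-× (e ∈E? factor) (c e Finₚ.≟ i)) u v)
                       (onEdge-inFactor (colourIs i) u v)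
      pair : ∀ u v → onPair both u v ≡ inFactor u v ⋆ colourOf i u v
      pair u v = trans (cong₂ _+_ (half u v) (trans (half v u) (cong (_⋆ onEdge (colourIs i) v u) (inFactor-sym v u))))
        (sym (ℤₚ.*-distribˡ-+ (inFactor u v) (onEdge (colourIs i) u v) (onEdge (colourIs i) v u)))

    edgeCount-∑ : + edgeCount factor ≡ ∑[ i ← is ] (+ edgeCountInColour factor c i)
    edgeCount-∑ = begin
      + edgeCount factor
        ≡⟨ count-edges (_∈E? factor) ⟩
      ∑[ u ← vs ] ∑[ v ← vs ] onEdge (λ e → ⟦ e ∈E? factor ⟧) u v
        ≡⟨ ∑-cong vs (λ u → ∑-cong vs (λ v → split u v)) ⟩
      ∑[ u ← vs ] ∑[ v ← vs ] ∑[ i ← is ] onEdge (both i) u v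
        ≡⟨ sym (trans (∑-comm is vs _) (∑-cong vs (λ u → ∑-comm is vs _))) ⟩
      ∑[ i ← is ] ∑[ u ← vs ] ∑[ v ← vs ] onEdge (both i) u v
        ≡⟨ ∑-cong is (λ i → sym (count-edges (λ e → (e ∈E? factor) ×-dec (c e Finₚ.≟ i)))) ⟩
      ∑[ i ← is ] (+ edgeCountInColour factor c i) ∎
      where
      open ≡-Reasoning
      both : Fin k → Edge N → ℤ
      both i e = ⟦ (e ∈E? factor) ×-dec (c e Finₚ.≟ i) ⟧
      split : ∀ u v → onEdge (λ e → ⟦ e ∈E? factor ⟧) u v ≡ ∑[ i ← is ] onEdge (both i) u v
      split u v with u Finₚ.<? v
      ... | no _    = sym (∑-zero is (λ _ → refl))
      ... | yes u<v = sym (begin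
        ∑[ i ← is ] both i e
          ≡⟨ ∑-cong is (λ i → ⟦⟧-× (e ∈E? factor) (c e Finₚ.≟ i)) ⟩
        ∑[ i ← is ] (⟦ e ∈E? factor ⟧ ⋆ colourIs i e)
          ≡⟨ trans (∑-*ˡ is ⟦ e ∈E? factor ⟧ _) (cong (⟦ e ∈E? factor ⟧ ⋆_) (∑-colourIs e)) ⟩
        ⟦ e ∈E? factor ⟧ ⋆ 1ℤ
          ≡⟨ ℤₚ.*-identityʳ ⟦ e ∈E? factor ⟧ ⟩
        ⟦ e ∈E? factor ⟧ ∎)
        where
        e : Edge N
        e = u , v , u<v

    -- Follows from the coloured counts: adjacent vertices of a copy have different places, and a
    -- pair of different vertices carries exactly one colour.
    edgeCount-placed : + 2 ⋆ + edgeCount factor ≡ + m ⋆ ∑[ a ← allFin r ] ∑[ b ← allFin r ] adjacency a b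
    edgeCount-placed = begin
      + 2 ⋆ + edgeCount factor
        ≡⟨ trans (cong (+ 2 ⋆_) edgeCount-∑) (sym (∑-*ˡ is (+ 2) _)) ⟩
      ∑[ i ← is ] (+ 2 ⋆ + edgeCountInColour factor c i)
        ≡⟨ trans (∑-cong is edgeCountInColour-placed) (trans (∑-comm is (allFin m) _)
             (∑-cong (allFin m) (λ j → trans (∑-comm is (allFin r) _)
               (∑-cong (allFin r) (λ a → ∑-comm is (allFin r) _))))) ⟩
      ∑[ j ← allFin m ] ∑[ a ← allFin r ] ∑[ b ← allFin r ] ∑[ i ← is ] (adjacency a b ⋆ colourOf i (place (j , a)) (place (j , b)))
        ≡⟨ ∑-cong (allFin m) (λ j → ∑-cong (allFin r) (λ a → ∑-cong (allFin r) (edge j a))) ⟩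
      ∑[ j ← allFin m ] ∑[ a ← allFin r ] ∑[ b ← allFin r ] adjacency a b
        ≡⟨ trans (∑-const (allFin m) _) (cong (_⋆ (∑[ a ← allFin r ] ∑[ b ← allFin r ] adjacency a b)) (length-allFin m)) ⟩
      + m ⋆ ∑[ a ← allFin r ] ∑[ b ← allFin r ] adjacency a b ∎
      where
      open ≡-Reasoning
      place-injective : ∀ {x y} → place x ≡ place y → x ≡ y
      place-injective {x} {y} eq = trans (sym (unplace-place x)) (trans (cong unplace eq) (unplace-place y))
      edge : ∀ j a b → ∑[ i ← is ] (adjacency a b ⋆ colourOf i (place (j , a)) (place (j , b))) ≡ adjacency a b
      edge j a b = trans (∑-*ˡ is (adjacency a b) _) (cases (a ~? b))
        where
        S : ℤ
        S = ∑[ i ← is ] colourOf i (place (j , a)) (place (j , b))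
        cases : (d : Dec (a ~ b)) → ⟦ d ⟧ ⋆ S ≡ ⟦ d ⟧
        cases (no _)    = refl
        cases (yes adj) = trans (ℤₚ.*-identityˡ S) (∑-colourOf-≢ (λ eq →
          SimpleGraph.loopless H a (subst (a ~_) (sym (Productₚ.,-injectiveʳ (place-injective eq))) adj)))

-- From integer to rational deviations

toℚᵘ-/ : ∀ i n .{{_ : NonZero n}} → ℚ.toℚᵘ (i / n) ℚᵘ.≃ (i ℚᵘ./ n)
toℚᵘ-/ i (suc n) = ℚₚ.toℚᵘ-fromℚᵘ (mkℚᵘ i n)

/1-mono-≤ : ∀ {i j} → i ≤ℤ j → i / 1 ≤ℚ j / 1
/1-mono-≤ {i} {j} i≤j = ℚₚ.toℚᵘ-cancel-≤ (begin
  ℚ.toℚᵘ (i / 1)  ≃⟨ toℚᵘ-/ i 1 ⟩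
  i ℚᵘ./ 1        ≤⟨ ℚᵘ.*≤* (ℤₚ.*-monoʳ-≤-nonNeg 1ℤ i≤j) ⟩
  j ℚᵘ./ 1        ≃⟨ toℚᵘ-/ j 1 ⟨
  ℚ.toℚᵘ (j / 1)  ∎)
  where open ℚᵘₚ.≤-Reasoning

/1-homo-+ : ∀ i j → i / 1 ℚ.+ j / 1 ≡ (i + j) / 1
/1-homo-+ i j = ℚₚ.toℚᵘ-injective (begin
  ℚ.toℚᵘ (i / 1 ℚ.+ j / 1)              ≈⟨ ℚₚ.toℚᵘ-homo-+ (i / 1) (j / 1) ⟩
  ℚ.toℚᵘ (i / 1) ℚᵘ.+ ℚ.toℚᵘ (j / 1)    ≈⟨ ℚᵘₚ.+-cong (toℚᵘ-/ i 1) (toℚᵘ-/ j 1) ⟩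
  (i ℚᵘ./ 1) ℚᵘ.+ (j ℚᵘ./ 1)            ≈⟨ ℚᵘ.*≡* (same i j) ⟩
  (i + j) ℚᵘ./ 1                        ≈⟨ toℚᵘ-/ (i + j) 1 ⟨
  ℚ.toℚᵘ ((i + j) / 1)                  ∎)
  where
  open ℚᵘₚ.≃-Reasoning
  same : ∀ i j → (i ⋆ 1ℤ + j ⋆ 1ℤ) ⋆ 1ℤ ≡ (i + j) ⋆ 1ℤ
  same = solve-∀

sum-≤-∑ : ∀ n (t : Fin n → ℚ) (g : Fin n → ℤ) → (∀ i → t i ≤ℚ g i / 1) → sum t ≤ℚ ∑ (allFin n) g / 1
sum-≤-∑ zero    t g t≤g = ℚₚ.≤-refl
sum-≤-∑ (suc n) t g t≤g = begin
  t Fin.zero ℚ.+ sum (t ∘ Fin.suc)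
    ≤⟨ ℚₚ.+-mono-≤ (t≤g Fin.zero) (sum-≤-∑ n (t ∘ Fin.suc) (g ∘ Fin.suc) (t≤g ∘ Fin.suc)) ⟩
  g Fin.zero / 1 ℚ.+ ∑ (allFin n) (g ∘ Fin.suc) / 1
    ≡⟨ /1-homo-+ (g Fin.zero) (∑ (allFin n) (g ∘ Fin.suc)) ⟩
  (g Fin.zero + ∑ (allFin n) (g ∘ Fin.suc)) / 1
    ≡⟨ cong (λ z → (g Fin.zero + z) / 1) (sym (∑-tabulate {n = n} Fin.suc g)) ⟩
  ∑ (allFin (suc n)) g / 1 ∎
  where open ℚₚ.≤-Reasoning

-- The left-hand side equals |k a - b| / k; the bound gives away the denominator.
∣a-b/k∣≤ : ∀ k .{{_ : NonZero k}} (a b : ℤ) → ℚ.∣ a / 1 ℚ.- b / k ∣ ≤ℚ ∥ + k ⋆ a - b ∥ / 1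
∣a-b/k∣≤ k@(suc k-1) a b = ℚₚ.toℚᵘ-cancel-≤ (begin
  ℚ.toℚᵘ ℚ.∣ a / 1 ℚ.- b / k ∣
    ≃⟨ ℚₚ.toℚᵘ-homo-∣-∣ (a / 1 ℚ.- b / k) ⟩
  ℚᵘ.∣ ℚ.toℚᵘ (a / 1 ℚ.- b / k) ∣
    ≃⟨ ℚᵘₚ.∣-∣-cong (ℚᵘₚ.≃-trans (ℚₚ.toℚᵘ-homo-+ (a / 1) (ℚ.- (b / k)))
         (ℚᵘₚ.+-cong (toℚᵘ-/ a 1) (ℚᵘₚ.≃-trans (ℚₚ.toℚᵘ-homo‿- (b / k)) (ℚᵘₚ.-‿cong (toℚᵘ-/ b k))))) ⟩
  ℚᵘ.∣ (a ℚᵘ./ 1) ℚᵘ.- (b ℚᵘ./ k) ∣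
    ≤⟨ ℚᵘ.*≤* (subst₂ _≤ℤ_ (sym (trans (ℤₚ.*-identityʳ _) (cong ∥_∥ (numerator a (+ k) b)))) refl bound) ⟩
  ∥ + k ⋆ a - b ∥ ℚᵘ./ 1
    ≃⟨ toℚᵘ-/ ∥ + k ⋆ a - b ∥ 1 ⟨
  ℚ.toℚᵘ (∥ + k ⋆ a - b ∥ / 1) ∎)
  where
  open ℚᵘₚ.≤-Reasoning
  numerator : ∀ a k b → a ⋆ k + (- b) ⋆ 1ℤ ≡ k ⋆ a - b
  numerator = solve-∀
  bound : ∥ + k ⋆ a - b ∥ ≤ℤ ∥ + k ⋆ a - b ∥ ⋆ + (1 * k)
  bound = subst (_≤ℤ ∥ + k ⋆ a - b ∥ ⋆ + (1 * k)) (ℤₚ.*-identityʳ _)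
    (*-monoˡ (0≤∥∥ (+ k ⋆ a - b)) (+≤+ (s≤s z≤n)))

-- Sums over ordered pairs count each edge twice; the spare factor 2 only enlarges the right-hand
-- side.
∣a-b/k∣≤-doubled : ∀ k .{{_ : NonZero k}} (a b : ℤ) {x z : ℤ} → + 2 ⋆ a ≡ x → + 2 ⋆ b ≡ z →
                   ℚ.∣ a / 1 ℚ.- b / k ∣ ≤ℚ ∥ + k ⋆ x - z ∥ / 1
∣a-b/k∣≤-doubled k a b refl refl = ℚₚ.≤-trans (∣a-b/k∣≤ k a b) (/1-mono-≤ (begin
  ∥ w ∥                             ≤⟨ ≤-by ∥ w ∥ (0≤∥∥ w) (twice ∥ w ∥) ⟩
  + 2 ⋆ ∥ w ∥                       ≡⟨ sym (∥i*j∥ (+ 2) w) ⟩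
  ∥ + 2 ⋆ w ∥                       ≡⟨ cong ∥_∥ (distrib (+ k) a b) ⟩
  ∥ + k ⋆ (+ 2 ⋆ a) - + 2 ⋆ b ∥     ∎))
  where
  open ℤₚ.≤-Reasoning
  w : ℤ
  w = + k ⋆ a - b
  twice : ∀ x → + 2 ⋆ x - x ≡ x
  twice = solve-∀
  distrib : ∀ k a b → + 2 ⋆ (k ⋆ a - b) ≡ k ⋆ (+ 2 ⋆ a) - + 2 ⋆ b
  distrib = solve-∀

colourDeviation-≤ : ∀ {k N} .{{_ : NonZero k}} (F : SimpleGraph N) (c : Colouring k N) (x : Fin k → ℤ) {z T : ℤ} →
                    (∀ i → + 2 ⋆ + edgeCountInColour F c i ≡ x i) → + 2 ⋆ + edgeCount F ≡ z →
                    ∑[ i ← allFin k ] ∥ + k ⋆ x i - z ∥ ≤ℤ T → colourDeviation F c ≤ℚ T / 1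
colourDeviation-≤ {k} F c x {z} x≡ z≡ ≤T = ℚₚ.≤-trans
  (sum-≤-∑ k _ (λ i → ∥ + k ⋆ x i - z ∥)
    (λ i → ∣a-b/k∣≤-doubled k (+ edgeCountInColour F c i) (+ edgeCount F) (x≡ i) z≡))
  (/1-mono-≤ ≤T)

-- The explicit constant

discrepancyBound≤ : ∀ k r → 2 ≤ k → 2 ≤ r → discrepancyBound k r ≤ (8 * k * r) ^ ((8 * k * r) ^ k)
discrepancyBound≤ k r 2≤k 2≤r = begin
  (4 * k * d) ^ k * (k * (k * (d * d)) ℕ.+ 2 * (r * r * (k * d ℕ.+ 1)))
    -- Factors are compared with powers of `A`: 4 k d ≤ A ^ 4, and each of the two summands is at
    -- most A ^ 8. Since A ≥ 2, their sum costs one more power.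
    ≤⟨ ℕₚ.*-mono-≤ (ℕₚ.^-monoˡ-≤ k (mul 1 3 4k≤A d≤)) (sum≤ 8 G≤ B≤) ⟩
  (A ^ 4) ^ k * A ^ 9
    ≡⟨ cong (_* A ^ 9) (ℕₚ.^-*-assoc A 4 k) ⟩
  A ^ (4 * k) * A ^ 9
    ≡⟨ sym (ℕₚ.^-distribˡ-+-* A (4 * k) 9) ⟩
  A ^ (4 * k ℕ.+ 9)
    ≤⟨ ℕₚ.^-monoʳ-≤ A exponent ⟩
  A ^ (A ^ k) ∎
  where
  open ℕₚ.≤-Reasoning
  A d : ℕ
  A = 8 * k * r
  d = r * (r * r)

  1≤k : 1 ≤ k
  1≤k = ℕₚ.≤-trans (s≤s z≤n) 2≤k
  1≤r : 1 ≤ r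
  1≤r = ℕₚ.≤-trans (s≤s z≤n) 2≤r

  instance
    k≢0 : NonZero k
    k≢0 = ℕ.>-nonZero 1≤k
    r≢0 : NonZero r
    r≢0 = ℕ.>-nonZero 1≤r
    A≢0 : NonZero A
    A≢0 = ℕₚ.m*n≢0 (8 * k) r {{ℕₚ.m*n≢0 8 k}}

  32≤A : 32 ≤ A
  32≤A = ℕₚ.*-mono-≤ (ℕₚ.*-monoʳ-≤ 8 2≤k) 2≤r

  pow1 : ∀ {x} → x ≤ A → x ≤ A ^ 1
  pow1 {x} = subst (x ≤_) (sym (ℕₚ.^-identityʳ A))

  mul : ∀ a b {x y} → x ≤ A ^ a → y ≤ A ^ b → x * y ≤ A ^ (a ℕ.+ b)
  mul a b {x} {y} x≤ y≤ = subst (x * y ≤_) (sym (ℕₚ.^-distribˡ-+-* A a b)) (ℕₚ.*-mono-≤ x≤ y≤)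

  sum≤ : ∀ a {x y} → x ≤ A ^ a → y ≤ A ^ a → x ℕ.+ y ≤ A ^ suc a
  sum≤ a {x} {y} x≤ y≤ = begin
    x ℕ.+ y                  ≤⟨ ℕₚ.+-mono-≤ x≤ y≤ ⟩
    A ^ a ℕ.+ A ^ a          ≡⟨ cong (A ^ a ℕ.+_) (sym (ℕₚ.+-identityʳ (A ^ a))) ⟩
    2 * A ^ a                ≤⟨ ℕₚ.*-monoˡ-≤ (A ^ a) (ℕₚ.≤-trans (s≤s (s≤s z≤n)) 32≤A) ⟩
    A ^ suc a                ∎

  8k≤A : 8 * k ≤ A
  8k≤A = ℕₚ.m≤m*n (8 * k) r

  4k≤A : 4 * k ≤ A ^ 1
  4k≤A = pow1 (ℕₚ.≤-trans (ℕₚ.*-monoˡ-≤ k {4} {8} (s≤s (s≤s (s≤s (s≤s z≤n))))) 8k≤A)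

  k≤A : k ≤ A ^ 1
  k≤A = pow1 (ℕₚ.≤-trans (ℕₚ.m≤n*m k 8) 8k≤A)

  r≤A : r ≤ A ^ 1
  r≤A = pow1 (ℕₚ.m≤n*m r (8 * k) {{ℕₚ.m*n≢0 8 k}})

  2≤A : 2 ≤ A ^ 1
  2≤A = pow1 (ℕₚ.≤-trans (s≤s (s≤s z≤n)) 32≤A)

  d≤ : d ≤ A ^ 3
  d≤ = mul 1 2 r≤A (mul 1 1 r≤A r≤A)

  G≤ : k * (k * (d * d)) ≤ A ^ 8
  G≤ = mul 1 7 k≤A (mul 1 6 k≤A (mul 3 3 d≤ d≤))

  B≤ : 2 * (r * r * (k * d ℕ.+ 1)) ≤ A ^ 8
  B≤ = mul 1 7 2≤A (mul 2 5 (mul 1 1 r≤A r≤A) (sum≤ 4 (mul 1 3 k≤A d≤) (ℕₚ.m^n>0 A 4)))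

  exponent : 4 * k ℕ.+ 9 ≤ A ^ k
  exponent = ℕₚ.≤-trans (linear≤ k 1≤k) (ℕₚ.^-monoˡ-≤ k 32≤A)
    where
    linear≤ : ∀ n → 1 ≤ n → 4 * n ℕ.+ 9 ≤ 32 ^ n
    -- Here 4 + 9 = 13 and 13 + 19 = 32.
    linear≤ (suc zero)      _ = ℕₚ.m≤n⇒m≤n+o 19 ℕₚ.≤-refl
    linear≤ (suc n@(suc _)) _ = begin
      4 * suc n ℕ.+ 9          ≡⟨ cong (ℕ._+ 9) (ℕₚ.*-suc 4 n) ⟩
      4 ℕ.+ (4 * n ℕ.+ 9)      ≤⟨ ℕₚ.+-mono-≤ (ℕₚ.*-monoʳ-≤ 4 (ℕₚ.m^n>0 32 n)) (linear≤ n (s≤s z≤n)) ⟩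
      4 * 32 ^ n ℕ.+ 32 ^ n    ≡⟨ ℕₚ.+-comm (4 * 32 ^ n) (32 ^ n) ⟩
      5 * 32 ^ n               ≤⟨ ℕₚ.*-monoˡ-≤ (32 ^ n) (ℕₚ.m≤m+n 5 27) ⟩
      32 ^ suc n               ∎

-- From the rearrangement to the factor

almost-balanced-factor : ∀ {k r} m N .{{_ : NonZero k}} .{{_ : NonZero r}} .{{_ : NonZero m}} → m * r ≡ N →
                         (H : SimpleGraph r) (c : Colouring k N) → Balanced c →
                         ∃[ F ] IsFactor H F × colourDeviation F c ≤ℚ + discrepancyBound k r / 1
almost-balanced-factor {k} {r} m N refl H c bal =
  factor , isFactor ,
  colourDeviation-≤ factor c (λ i → weight ((χ ∘₂ to) i) id) edgeCountInColour-placed edgeCount-placed (proj₂ arrangement)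
  where
  initial : Position m r ↔ Fin (m * r)
  initial = ↔-sym Finₚ.*↔×

  place : Position m r → Fin (m * r)
  place = Inverse.to initial

  ps : List (Position m r)
  ps = positions m r

  open SimpleGraph H using (adjacent?)
  open Weights {m} {r} (λ a b → ⟦ adjacent? a b ⟧) using (weight)
  open Descent {k} {m} {r} (λ a b → ⟦ adjacent? a b ⟧) (λ a b → 0≤⟦⟧ (adjacent? a b)) (λ a b → ⟦⟧≤1 (adjacent? a b))
    (λ a → ⟦⟧-no (adjacent? a a) (SimpleGraph.loopless H a))

  χ : Colours
  χ i x y = colourOf c i (place x) (place y)

  admissible : Admissible χ
  admissible = record
    { unit     = λ i x y → 0≤colourOf c i (place x) (place y) , colourOf≤1 c i (place x) (place y)
    ; balanced = λ i → trans (cong (+ k ⋆_) (trans (∑-cong ps (λ x → reindex (colourOf c i (place x))))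
                                                  (reindex (λ u → ∑ (allFin (m * r)) (colourOf c i u)))))
        (trans (balanced-colourOf c bal i) (cong (λ q → q ⋆ (q - 1ℤ)) (trans (ℤₚ.pos-* m r) (sym (length-positions m r)))))
    }
    where
    reindex : (f : Fin (m * r) → ℤ) → ∑ ps (f ∘ place) ≡ ∑ (allFin (m * r)) f
    reindex = ∑-reindex _≟ₚ_ Finₚ._≟_ ps (allFin (m * r)) (positions-enumerates m r) (allFin-enumerates (m * r))
      place (Inverse.from initial) (λ _ → Inverse.inverseˡ initial refl) (λ _ → Inverse.inverseʳ initial refl)

  arrangement : Σ[ σ ∈ Rearrangement ] discrepancy (χ ∘₂ Rearrangement.to σ) ≤ℤ + discrepancyBound k r
  arrangement = small-discrepancy χ admissible

  open Rearrangement (proj₁ arrangement)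

  placement : Position m r ↔ Fin (m * r)
  -- The rearrangement acts before the initial placement, so that the counts in `Placed` unfold to
  -- weights of `χ ∘₂ to`.
  placement = initial ↔-∘ mk↔ₛ′ to from to-from from-to

  open Placed c H placement

theorem1p1 : (k r : ℕ) .{{_ : NonZero k}} → 2 ≤ k → 2 ≤ r →
    let Works : ℚ → Set₁
        Works C = (H : SimpleGraph r) (n : ℕ) → 1 ≤ n →
          (c : Colouring k (n * r * k)) → Balanced c →
          ∃[ F ] IsFactor H F × colourDeviation F c ≤ℚ C
    in (∃[ C ] Works C) × Works (+ ((8 * k * r) ^ ((8 * k * r) ^ k)) / 1)
theorem1p1 k r 2≤k 2≤r = (_ , works) , works
  where
  works : (H : SimpleGraph r) (n : ℕ) → 1 ≤ n → (c : Colouring k (n * r * k)) → Balanced c →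
          ∃[ F ] IsFactor H F × colourDeviation F c ≤ℚ + ((8 * k * r) ^ ((8 * k * r) ^ k)) / 1
  -- The factor consists of n k copies, and `swap` reconciles n k r with the given order n r k.
  works H n 1≤n c bal = enlarge (almost-balanced-factor (n * k) (n * r * k)
      {{it}} {{ℕ.>-nonZero (ℕₚ.≤-trans (s≤s z≤n) 2≤r)}} {{ℕₚ.m*n≢0 n k {{ℕ.>-nonZero 1≤n}}}} (swap n k r) H c bal)
    where
    swap : ∀ n k r → n * k * r ≡ n * r * k
    swap n k r = trans (ℕₚ.*-assoc n k r) (trans (cong (n *_) (ℕₚ.*-comm k r)) (sym (ℕₚ.*-assoc n r k)))
    enlarge : ∃[ F ] IsFactor H F × colourDeviation F c ≤ℚ + discrepancyBound k r / 1 →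
              ∃[ F ] IsFactor H F × colourDeviation F c ≤ℚ + ((8 * k * r) ^ ((8 * k * r) ^ k)) / 1
    enlarge (F , isFactor , dev≤) = F , isFactor , ℚₚ.≤-trans dev≤ (/1-mono-≤ (+≤+ (discrepancyBound≤ k r 2≤k 2≤r)))
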